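{- Let $G$ be a doubly-connected graph of order $n\ge 5$ and let $\overline G$ be its complement. Then $4\le\lambda(G)+\lambda(\overline G)\le 2n-5$. Moreover, up to isomorphism: (i) $\lambda(G)+\lambda(\overline G)=4$ if and only if $G\in\{P_5,C_5,B,H\}$; (ii) $\lambda(G)+\lambda(\overline G)=2n-5$ if and only if $G$ is one of $K_2(r,s)$, $\overline K_2(r,s)$ (for some integers $r,s\ge 1$), $K^s_{1,r}$, $\overline K^s_{1,r}$ (for some integers $r,s$ with $2\le s\le r-1$).
   Context: Graphs are finite, simple and undirected. A graph $G$ is doubly-connected if both $G$ and its complement $\overline G$ are connected. For a graph $G=(V,E)$, $N(v)$ is the open neighborhood of $v$. A set $D\subseteq V$ is a locating-dominating set (LD-set) if $N(u)\cap D\neq\emptyset$ for every $u\in V\setminus D$ and $N(u)\cap D\ne N(v)\cap D$ for every two distinct vertices $u,v\in V\setminus D$. The location-domination number $\lambda(G)$ is the minimum cardinality of a locating-dominating set of $G$. $P_5$ and $C_5$ are the path and cycle on 5 vertices. $B$ is the bull graph: a triangle with one pendant vertex attached to each of two distinct vertices of the triangle. $H=\overline{P_5}$ is the house graph (a 5-cycle with one chord). For positive integers $r,s$, $K_2(r,s)$ is the double star obtained by joining by an edge the central vertices of the stars $K_{1,r}$ and $K_{1,s}$ (so it has $r+s+2$ vertices). For $2\le s\le r-1$, $K^s_{1,r}$ is the graph obtained from the star $K_{1,r}$ by adding a new vertex adjacent to exactly $s$ leaves of the star (so it has $r+2$ vertices). $\overline K_2(r,s)$ and $\overline K^s_{1,r}$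 denote the complements of $K_2(r,s)$ and $K^s_{1,r}$. -}

module Defs where

open import Data.Bool.Base using (Bool; true; false; not; _∧_; _∨_; T)
open import Data.Bool.Properties using (∨-comm) renaming (_≟_ to _≟ᵇ_)
open import Data.Fin.Base using (Fin; zero; suc; toℕ; splitAt)
open import Data.Fin.Patterns using (0F; 1F; 2F; 3F; 4F)
open import Data.Fin.Properties using (_≟_; all?)
open import Data.Fin.Subset using (Subset; _∈_; _∉_; _∩_; ⊤; Nonempty; ∣_∣)
open import Data.Fin.Subset.Properties using (_∈?_; ∈⊤; nonempty?; anySubset?)
open import Data.List.Base using (List; []; _∷_)
import Data.List.Membership.DecPropositional as DecMembership
open import Data.Nat.Base using (ℕ; zero; suc; _+_; _≤_; _<_; _<ᵇ_)
open import Data.Nat.Induction using (<-wellFounded)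
open import Data.Nat.Properties using (_<?_; ≮⇒≥)
open import Data.Product.Base using (∃; Σ-syntax; _×_; _,_; proj₁; proj₂)
open import Data.Product.Properties using () renaming (≡-dec to ×-≡-dec)
open import Data.Sum.Base using (_⊎_; inj₁; inj₂)
open import Data.Vec.Base using (tabulate)
open import Data.Vec.Properties using () renaming (≡-dec to Vec-≡-dec)
open import Function.Base using (const)
open import Function.Bundles using (_↔_; Inverse)
open import Induction.WellFounded using (Acc; acc)
open import Relation.Binary.Construct.Closure.ReflexiveTransitive using (Star)
open import Relation.Binary.Definitions using (Universal)
open import Relation.Binary.PropositionalEquality
  using (_≡_; _≢_; refl; sym; cong; cong₂)
open import Relation.Nullary.Decidable
  using (Dec; does; yes; no; ¬?; _×-dec_; _→-dec_; dec-true)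
open import Relation.Nullary.Negation using (contradiction)

private
  variable
    m n : ℕ

-- A graph of order n has vertex set Fin n.
record Graph (n : ℕ) : Set where
  field
    edge        : Fin n → Fin n → Bool
    edge-sym    : ∀ u v → edge u v ≡ edge v u
    edge-irrefl : ∀ v → edge v v ≡ false

open Graph public

Adj : Graph n → Fin n → Fin n → Set
Adj G u v = T (edge G u v)

distinct : Fin n → Fin n → Bool
distinct u v = not (does (u ≟ v))

distinct-sym : (u v : Fin n) → distinct u v ≡ distinct v u
distinct-sym u v with u ≟ v | v ≟ u
... | yes _   | yes _   = refl
... | no  _   | no  _   = refl
... | yes u≡v | no  v≢u = contradiction (sym u≡v) v≢u
... | no  u≢v | yes v≡u = contradiction (sym v≡u) u≢v

distinct-irrefl : (v : Fin n) → distinct v v ≡ false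
distinct-irrefl v = cong not (dec-true (v ≟ v) refl)

complement : Graph n → Graph n
complement G .edge u v = distinct u v ∧ not (edge G u v)
complement G .edge-sym u v =
  cong₂ _∧_ (distinct-sym u v) (cong not (edge-sym G u v))
complement G .edge-irrefl v = cong (_∧ not (edge G v v)) (distinct-irrefl v)

Connected : Graph n → Set
Connected G = Universal (Star (Adj G))

DoublyConnected : Graph n → Set
DoublyConnected G = Connected G × Connected (complement G)

infix 4 _≅_

_≅_ : Graph m → Graph n → Set
_≅_ {m} {n} G H = Σ[ f ∈ Fin m ↔ Fin n ]
  (∀ u v → edge G u v ≡ edge H (Inverse.to f u) (Inverse.to f v))

N : Graph n → Fin n → Subset n
N G v = tabulate (edge G v)

IsDominating : Graph n → Subset n → Set
IsDominating G D = ∀ u → u ∉ D → Nonempty (N G u ∩ D)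

IsLocating : Graph n → Subset n → Set
IsLocating G D = ∀ u v → u ∉ D → v ∉ D → u ≢ v → N G u ∩ D ≢ N G v ∩ D

IsLDSet : Graph n → Subset n → Set
IsLDSet G D = IsDominating G D × IsLocating G D

isLDSet? : (G : Graph n) (D : Subset n) → Dec (IsLDSet G D)
isLDSet? G D =
  all? (λ u → ¬? (u ∈? D) →-dec nonempty? (N G u ∩ D))
  ×-dec
  all? (λ u → all? λ v →
    ¬? (u ∈? D) →-dec (¬? (v ∈? D) →-dec (¬? (u ≟ v) →-dec
      ¬? (Vec-≡-dec _≟ᵇ_ (N G u ∩ D) (N G v ∩ D)))))

IsLDNumber : Graph n → ℕ → Set
IsLDNumber G k =
  (∃ λ D → IsLDSet G D × ∣ D ∣ ≡ k) × (∀ D → IsLDSet G D → k ≤ ∣ D ∣)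

⊤-isLDSet : (G : Graph n) → IsLDSet G ⊤
⊤-isLDSet G = (λ u u∉⊤ → contradiction ∈⊤ u∉⊤)
            , (λ u _ u∉⊤ → contradiction ∈⊤ u∉⊤)

minimise : (G : Graph n) (D : Subset n) → IsLDSet G D → Acc _<_ ∣ D ∣ →
           ∃ (IsLDNumber G)
minimise G D ld (acc rs)
  with anySubset? (λ D′ → isLDSet? G D′ ×-dec (∣ D′ ∣ <? ∣ D ∣))
... | yes (D′ , ld′ , lt) = minimise G D′ ld′ (rs lt)
... | no  none            = ∣ D ∣ , (D , ld , refl) ,
  λ D′ ld′ → ≮⇒≥ (λ lt → none (D′ , ld′ , lt))

ldNumber-exists : (G : Graph n) → ∃ (IsLDNumber G)
ldNumber-exists G = minimise G ⊤ (⊤-isLDSet G) (<-wellFounded _)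

ldNumber : Graph n → ℕ
ldNumber G = proj₁ (ldNumber-exists G)

ldNumber-isLDNumber : (G : Graph n) → IsLDNumber G (ldNumber G)
ldNumber-isLDNumber G = proj₂ (ldNumber-exists G)

-- Each pair listed is an undirected edge.
fromEdges : List (Fin n × Fin n) → Graph n
fromEdges {n} es = record
  { edge        = λ u v → distinct u v ∧ (listed u v ∨ listed v u)
  ; edge-sym    = λ u v → cong₂ _∧_ (distinct-sym u v)
                                    (∨-comm (listed u v) (listed v u))
  ; edge-irrefl = λ v → cong (_∧ (listed v v ∨ listed v v)) (distinct-irrefl v)
  }
  where
  open DecMembership (×-≡-dec (_≟_ {n}) (_≟_ {n})) using () renaming (_∈?_ to _∈ₗ?_)
  listed : Fin n → Fin n → Bool
  listed u v = does ((u , v) ∈ₗ? es)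

P₅ : Graph 5
P₅ = fromEdges ((0F , 1F) ∷ (1F , 2F) ∷ (2F , 3F) ∷ (3F , 4F) ∷ [])

C₅ : Graph 5
C₅ = fromEdges ((0F , 1F) ∷ (1F , 2F) ∷ (2F , 3F) ∷ (3F , 4F) ∷ (4F , 0F) ∷ [])

-- The triangle is 0, 1, 2.
Bull : Graph 5
Bull = fromEdges ((0F , 1F) ∷ (1F , 2F) ∷ (2F , 0F) ∷ (0F , 3F) ∷ (1F , 4F) ∷ [])

House : Graph 5
House = complement P₅

edgeless : ∀ n → Graph n
edgeless n = record
  { edge        = λ _ _ → false
  ; edge-sym    = λ _ _ → refl
  ; edge-irrefl = λ _ → refl
  }

-- The new vertex is zero; its neighbours are the old vertices u with f u ≡ true.
addVertex : Graph n → (Fin n → Bool) → Graph (suc n)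
addVertex {n} G f = record { edge = e ; edge-sym = e-sym ; edge-irrefl = e-irrefl }
  where
  e : Fin (suc n) → Fin (suc n) → Bool
  e zero    zero    = false
  e zero    (suc v) = f v
  e (suc u) zero    = f u
  e (suc u) (suc v) = edge G u v

  e-sym : ∀ u v → e u v ≡ e v u
  e-sym zero    zero    = refl
  e-sym zero    (suc v) = refl
  e-sym (suc u) zero    = refl
  e-sym (suc u) (suc v) = edge-sym G u v

  e-irrefl : ∀ v → e v v ≡ false
  e-irrefl zero    = refl
  e-irrefl (suc v) = edge-irrefl G v

-- K_{1,r}, with centre zero
star : ∀ r → Graph (suc r)
star r = addVertex (edgeless r) (const true)

-- The disjoint union of G and H plus an edge joining their vertices zero.
joinAtZero : Graph (suc m) → Graph (suc n) → Graph (suc m + suc n)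
joinAtZero {m} {n} G H = record
  { edge        = λ u v → e (splitAt (suc m) u) (splitAt (suc m) v)
  ; edge-sym    = λ u v → e-sym (splitAt (suc m) u) (splitAt (suc m) v)
  ; edge-irrefl = λ v → e-irrefl (splitAt (suc m) v)
  }
  where
  V : Set
  V = Fin (suc m) ⊎ Fin (suc n)

  e : V → V → Bool
  e (inj₁ u)    (inj₁ v)    = edge G u v
  e (inj₂ u)    (inj₂ v)    = edge H u v
  e (inj₁ zero) (inj₂ zero) = true
  e (inj₂ zero) (inj₁ zero) = true
  e _           _           = false

  e-sym : ∀ u v → e u v ≡ e v u
  e-sym (inj₁ u)       (inj₁ v)       = edge-sym G u v
  e-sym (inj₂ u)       (inj₂ v)       = edge-sym H u v
  e-sym (inj₁ zero)    (inj₂ zero)    = refl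
  e-sym (inj₁ zero)    (inj₂ (suc _)) = refl
  e-sym (inj₁ (suc _)) (inj₂ zero)    = refl
  e-sym (inj₁ (suc _)) (inj₂ (suc _)) = refl
  e-sym (inj₂ zero)    (inj₁ zero)    = refl
  e-sym (inj₂ zero)    (inj₁ (suc _)) = refl
  e-sym (inj₂ (suc _)) (inj₁ zero)    = refl
  e-sym (inj₂ (suc _)) (inj₁ (suc _)) = refl

  e-irrefl : ∀ v → e v v ≡ false
  e-irrefl (inj₁ v) = edge-irrefl G v
  e-irrefl (inj₂ v) = edge-irrefl H v

doubleStar : ∀ r s → Graph (suc r + suc s)
doubleStar r s = joinAtZero (star r) (star s)

-- K^s_{1,r} for s ≤ r: the new vertex is adjacent to the first s leaves of the
-- star.  All choices of s leaves give isomorphic graphs.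
starPlus : ∀ r s → Graph (suc (suc r))
starPlus r s = addVertex (star r) chosen
  where
  chosen : Fin (suc r) → Bool
  chosen zero    = false
  chosen (suc i) = toℕ i <ᵇ s

{-# OPTIONS --safe #-}

-- Call a set of k vertices removable if its complement is locating-dominating,
-- so that λ(G) + k ≤ n iff G has a removable k-set.  A removable set of an
-- induced subgraph is removable in the whole graph; hence graphs without a
-- removable triple are described by forbidden induced subgraphs.  A
-- doubly-connected graph G contains an induced path P₄, whose end vertices form
-- a removable pair, so λ(G) ≤ n - 2, and likewise for the complement.  If G has
-- no removable triple, then inspecting the graphs obtained from P₄ by adding one
-- or two vertices shows that every vertex has the same neighbours on P₄ as some
-- vertex of P₄, and that G is P₄ with two of its vertices replaced by sets of
-- false twins: a double star or K^s_{1,r}.  If moreover n ≥ 5, the complement has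
-- a removable triple but no removable quadruple, which gives the upper bound and
-- its equality case.  Counting traces gives n < d + 2^d for d = λ(G), hence
-- 2 ≤ λ(G) for n ≥ 5; equality forces n = 5, and then G is one of the sixteen
-- extensions of P₄ by a vertex.
module Submission where

open import Defs
open import Data.Bool.Base using (Bool; true; false; not; _∧_; if_then_else_)
open import Data.Bool.Properties using (not-involutive; T-≡; ¬-not; ∧-identityʳ; ∧-zeroʳ)
  renaming (_≟_ to _≟ᵇ_)
open import Data.Fin.Base
  using (Fin; zero; suc; toℕ; fromℕ<; opposite; punchIn; punchOut; splitAt; join; _↑ˡ_; _↑ʳ_;
         funToFin; finToFun)
open import Data.Fin.Patterns using (0F; 1F; 2F; 3F)
open import Data.Fin.Permutation as Permutation using (insert; insert-punchIn)
open import Data.Fin.Properties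
  using (_≟_; any?; all?; suc-injective; injective⇒≤; finToFun-funToFin; opposite-involutive;
         punchInᵢ≢i; punchIn-punchOut; join-splitAt; splitAt-↑ʳ; toℕ-fromℕ<)
open import Data.Fin.Subset
  using (Subset; ⊥; _∈_; _∉_; _⊂_; _∪_; _∩_; ∣_∣; ⁅_⁆; inside; outside)
open import Data.Fin.Subset.Properties
  using (_∈?_; ∣p∣≤n; p⊂q⇒∣p∣<∣q∣; p⊆p∪q; q⊆p∪q; x∈⁅x⁆; x∈⁅y⁆⇒x≡y; x∈p∪q⁻; x∈p∩q⁺; x∈p∩q⁻)
open import Data.Nat.Base
  using (ℕ; zero; suc; _+_; _*_; _∸_; _^_; _≤_; _<_; _<ᵇ_; z≤n; s≤s; s≤s⁻¹)
open import Data.Nat.Properties as ℕ using ()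
open import Data.Nat.Tactic.RingSolver using (solve-∀)
open import Data.Product.Base using (∃; ∃₂; Σ-syntax; _×_; _,_; proj₁; proj₂)
open import Data.Sum.Base as Sum using (_⊎_; inj₁; inj₂; [_,_])
open import Data.Vec.Base using (Vec; []; _∷_; lookup; map; tabulate; here; there)
open import Data.Vec.Properties
  using (lookup-map; lookup∘tabulate; tabulate∘lookup; tabulate-cong; lookup-zipWith;
         lookup-replicate; []=⇒lookup; lookup⇒[]=)
  renaming (≡-dec to Vec-≡-dec)
open import Function.Base using (_∘_; id; const; case_of_)
open import Function.Bundles
  using (_⇔_; _↔_; Equivalence; Inverse; Injection; mk⇔; mk↔ₛ′)
open import Function.Properties.Inverse using (↔⇒↣)
open import Relation.Binary.Construct.Closure.ReflexiveTransitive using (Star; ε; _◅_)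
open import Relation.Binary.PropositionalEquality
  using (_≡_; _≢_; refl; sym; trans; cong; cong₂; subst; module ≡-Reasoning)
open import Relation.Nullary.Decidable
  using (Dec; yes; no; does; map′; from-yes; dec-true; dec-false; decidable-stable; ¬?;
         _×-dec_; _⊎-dec_; _→-dec_)
open import Relation.Nullary.Negation using (¬_; contradiction)
open import Relation.Unary using (Decidable)

private
  variable
    m n k : ℕ

-- Decision procedures for finite quantifiers

allVec? : ∀ k {P : Vec (Fin m) k → Set} → Decidable P → Dec (∀ v → P v)
allVec? zero    P? = map′ (λ { p [] → p }) (λ p → p []) (P? [])
allVec? (suc k) P? = map′ (λ { p (x ∷ v) → p x v }) (λ p x v → p (x ∷ v))
  (all? λ x → allVec? k λ v → P? (x ∷ v))

anyVec? : ∀ k {P : Vec (Fin m) k → Set} → Decidable P → Dec (∃ P)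
anyVec? zero    P? = map′ ([] ,_) (λ { ([] , p) → p }) (P? [])
anyVec? (suc k) P? = map′ (λ (x , v , p) → x ∷ v , p) (λ { (x ∷ v , p) → x , v , p })
  (any? λ x → anyVec? k λ v → P? (x ∷ v))

allBool? : {P : Bool → Set} → Decidable P → Dec (∀ b → P b)
allBool? P? = map′ (λ { (p , q) false → p ; (p , q) true → q }) (λ p → p false , p true)
  (P? false ×-dec P? true)

allSubset? : ∀ n {P : Subset n → Set} → Decidable P → Dec (∀ p → P p)
allSubset? zero    P? = map′ (λ { p [] → p }) (λ p → p []) (P? [])
allSubset? (suc n) P? = map′ (λ { p (b ∷ v) → p b v }) (λ p b v → p (b ∷ v))
  (allBool? λ b → allSubset? n λ v → P? (b ∷ v))

-- Induced subgraphs and removable sets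

infix 4 _↪_

record _↪_ (H : Graph m) (G : Graph n) : Set where
  field
    at           : Fin m → Fin n
    at-injective : ∀ {i j} → at i ≡ at j → i ≡ j
    at-edge      : ∀ i j → edge G (at i) (at j) ≡ edge H i j

open _↪_

Outside : Vec (Fin n) k → Fin n → Set
Outside s w = ∀ j → lookup s j ≢ w

-- The second condition forces the entries of `s` to be distinct, so such a vector is a set of
-- exactly `k` vertices.
IsRemovable : Graph n → Vec (Fin n) k → Set
IsRemovable G s =
  (∀ i → ∃ λ w → Outside s w × edge G (lookup s i) w ≡ true) ×
  (∀ i j → i ≢ j → ∃ λ w → Outside s w × edge G (lookup s i) w ≢ edge G (lookup s j) w)

Removable : Graph n → ℕ → Set
Removable G k = ∃ λ (s : Vec _ k) → IsRemovable G s

outside? : (s : Vec (Fin n) k) → Decidable (Outside s)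
outside? s w = all? λ j → ¬? (lookup s j ≟ w)

removable? : (G : Graph n) → ∀ k → Dec (Removable G k)
removable? G k = anyVec? k λ s →
  all? (λ i → any? λ w → outside? s w ×-dec (edge G (lookup s i) w ≟ᵇ true))
  ×-dec
  all? (λ i → all? λ j → ¬? (i ≟ j) →-dec
    any? λ w → outside? s w ×-dec ¬? (edge G (lookup s i) w ≟ᵇ edge G (lookup s j) w))

-- Witnesses stay outside the image by injectivity and keep their adjacencies because the subgraph
-- is induced. The other vertices of `G` only enlarge the locating-dominating set.
removable-↪ : {H : Graph m} {G : Graph n} → H ↪ G → Removable H k → Removable G k
removable-↪ {H = H} {G} φ (s , dom , loc) = map (at φ) s , dom′ , loc′
  where
  φs : ∀ i → lookup (map (at φ) s) i ≡ at φ (lookup s i)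
  φs i = lookup-map i (at φ) s

  out : ∀ {w} → Outside s w → Outside (map (at φ) s) (at φ w)
  out w∉s j eq = w∉s j (at-injective φ (trans (sym (φs j)) eq))

  φe : ∀ i w → edge G (lookup (map (at φ) s) i) (at φ w) ≡ edge H (lookup s i) w
  φe i w = trans (cong (λ x → edge G x (at φ w)) (φs i)) (at-edge φ _ w)

  dom′ : ∀ i → ∃ λ w → Outside (map (at φ) s) w × edge G (lookup (map (at φ) s) i) w ≡ true
  dom′ i with w , w∉s , e ← dom i = at φ w , out w∉s , trans (φe i w) e

  loc′ : ∀ i j → i ≢ j → ∃ λ w → Outside (map (at φ) s) w ×
    edge G (lookup (map (at φ) s) i) w ≢ edge G (lookup (map (at φ) s) j) w
  loc′ i j i≢j with w , w∉s , ne ← loc i j i≢j = at φ w , out w∉s , λ eq →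
    ne (trans (sym (φe i w)) (trans eq (φe j w)))

complement-edge : (G : Graph n) {u v : Fin n} → u ≢ v → edge (complement G) u v ≡ not (edge G u v)
complement-edge G {u} {v} u≢v with u ≟ v
... | yes u≡v = contradiction u≡v u≢v
... | no  _   = refl

complement-↪ : {H : Graph m} {G : Graph n} → H ↪ G → complement H ↪ complement G
complement-↪ φ .at = at φ
complement-↪ φ .at-injective = at-injective φ
complement-↪ {H = H} {G} φ .at-edge i j with i ≟ j
... | yes refl = edge-irrefl (complement G) (at φ i)
... | no i≢j = trans (complement-edge G (i≢j ∘ at-injective φ)) (cong not (at-edge φ i j))

-- The double complement agrees with `G` edge by edge but not definitionally, so properties pass
-- between the two along the identity embedding.
complement²-↪ : (G : Graph n) → complement (complement G) ↪ G
complement²-↪ G .at = id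
complement²-↪ G .at-injective = id
complement²-↪ G .at-edge i j with i ≟ j
... | yes refl = edge-irrefl G i
... | no i≢j = sym (not-involutive _)

↪-complement² : (G : Graph n) → G ↪ complement (complement G)
↪-complement² G .at = id
↪-complement² G .at-injective = id
↪-complement² G .at-edge i j = sym (at-edge (complement²-↪ G) i j)

↪-trans : ∀ {l} {F : Graph l} {H : Graph m} {G : Graph n} → F ↪ H → H ↪ G → F ↪ G
↪-trans φ ψ .at = at ψ ∘ at φ
↪-trans φ ψ .at-injective = at-injective φ ∘ at-injective ψ
↪-trans φ ψ .at-edge i j = trans (at-edge ψ _ _) (at-edge φ i j)

addVertex-↪ : {H : Graph m} {G : Graph n} (φ : H ↪ G) (v : Fin n) → (∀ i → at φ i ≢ v) →
  (f : Fin m → Bool) → (∀ i → edge G v (at φ i) ≡ f i) → addVertex H f ↪ G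
addVertex-↪ φ v v∉ f e .at zero    = v
addVertex-↪ φ v v∉ f e .at (suc i) = at φ i
addVertex-↪ φ v v∉ f e .at-injective {zero}  {zero}  eq = refl
addVertex-↪ φ v v∉ f e .at-injective {zero}  {suc j} eq = contradiction (sym eq) (v∉ j)
addVertex-↪ φ v v∉ f e .at-injective {suc i} {zero}  eq = contradiction eq (v∉ i)
addVertex-↪ φ v v∉ f e .at-injective {suc i} {suc j} eq = cong suc (at-injective φ eq)
addVertex-↪ {G = G} φ v v∉ f e .at-edge zero zero = edge-irrefl G v
addVertex-↪ φ v v∉ f e .at-edge zero (suc j) = e j
addVertex-↪ {G = G} φ v v∉ f e .at-edge (suc i) zero = trans (edge-sym G _ v) (e i)
addVertex-↪ φ v v∉ f e .at-edge (suc i) (suc j) = at-edge φ i j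

-- Finite checks on extensions of `P₄`

isZero : Fin n → Bool
isZero zero    = true
isZero (suc _) = false

-- The path 0 - 1 - 2 - 3.
P₄ : Graph 4
P₄ = addVertex (addVertex (star 1) isZero) isZero

abstract
  -- Used to derive injectivity from preservation of edges, and uniqueness of a kind from the
  -- neighbours on the path.
  P₄-pointDetermining : ∀ i j → (∀ k → edge P₄ i k ≡ edge P₄ j k) → i ≡ j
  P₄-pointDetermining = from-yes (all? λ i → all? λ j →
    (all? λ k → edge P₄ i k ≟ᵇ edge P₄ j k) →-dec (i ≟ j))

abstract
  -- All sixteen neighbourhoods on the path are tried; without a removable triple, only the empty
  -- one and those of path vertices survive.
  P₄-type : (t : Subset 4) → (t ≡ ⊥ ⊎ (∃ λ k → t ≡ N P₄ k)) ⊎ Removable (addVertex P₄ (lookup t)) 3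
  P₄-type = from-yes (allSubset? 4 λ t →
    (Vec-≡-dec _≟ᵇ_ t ⊥ ⊎-dec any? λ k → Vec-≡-dec _≟ᵇ_ t (N P₄ k)) ⊎-dec
    removable? (addVertex P₄ (lookup t)) 3)

abstract
  -- The outer vertex hangs on a vertex with the path neighbours of `j` and sees nothing of the path
  -- itself. Connectivity turns any vertex without path neighbours into such a configuration.
  P₄-distance2 : ∀ j → Removable (addVertex (addVertex P₄ (edge P₄ j)) isZero) 3
  P₄-distance2 = from-yes (all? λ j → removable? (addVertex (addVertex P₄ (edge P₄ j)) isZero) 3)

cons : {A : Set} → A → (Fin n → A) → Fin (suc n) → A
cons a f zero = a
cons a f (suc i) = f i

abstract
  -- The added vertices have the path neighbours of `i` and `j`, and `b` is their adjacency. The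
  -- surviving case says that adjacency of added vertices, too, can be read off from `P₄`.
  P₄-pair : ∀ i j b → (b ≡ false × edge P₄ i j ≡ false) ⊎
    Removable (addVertex (addVertex P₄ (edge P₄ i)) (cons b (edge P₄ j))) 3
  P₄-pair = from-yes (all? λ i → all? λ j → allBool? λ b →
    ((b ≟ᵇ false) ×-dec (edge P₄ i j ≟ᵇ false)) ⊎-dec
    removable? (addVertex (addVertex P₄ (edge P₄ i)) (cons b (edge P₄ j))) 3)
  

-- Removable sets and the location-domination number

-- Here and in `Separates` a vertex of `D` is the witness, as in `IsRemovable`, in place of a
-- comparison of intersections.
Dominates : Graph n → Subset n → Set
Dominates G D = ∀ u → u ∉ D → ∃ λ w → w ∈ D × edge G u w ≡ true

Separates : Graph n → Subset n → Set
Separates G D = ∀ u v → u ∉ D → v ∉ D → u ≢ v → ∃ λ w → w ∈ D × edge G u w ≢ edge G v w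

lookup-N∩ : (G : Graph n) (D : Subset n) → ∀ u w → lookup (N G u ∩ D) w ≡ edge G u w ∧ lookup D w
lookup-N∩ G D u w = trans (lookup-zipWith _∧_ w (N G u) D)
  (cong (_∧ lookup D w) (lookup∘tabulate (edge G u) w))

lookup-ext : {A : Set} {xs ys : Vec A n} → (∀ i → lookup xs i ≡ lookup ys i) → xs ≡ ys
lookup-ext {xs = xs} {ys} eq =
  trans (sym (tabulate∘lookup xs)) (trans (tabulate-cong eq) (tabulate∘lookup ys))

∉⇒lookup≡false : {D : Subset n} {w : Fin n} → w ∉ D → lookup D w ≡ false
∉⇒lookup≡false {D = D} {w} w∉D with lookup D w in eq
... | true  = contradiction (lookup⇒[]= w D eq) w∉D
... | false = refl

ldSet⇒dominates : (G : Graph n) {D : Subset n} → IsLDSet G D → Dominates G D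
ldSet⇒dominates G {D} (dom , _) u u∉D with w , w∈ ← dom u u∉D
  with w∈N , w∈D ← x∈p∩q⁻ (N G u) D w∈ =
  w , w∈D , trans (sym (lookup∘tabulate (edge G u) w)) ([]=⇒lookup w∈N)

ldSet⇒separates : (G : Graph n) {D : Subset n} → IsLDSet G D → Separates G D
ldSet⇒separates G {D} (_ , loc) u v u∉D v∉D u≢v
  with any? (λ w → (w ∈? D) ×-dec ¬? (edge G u w ≟ᵇ edge G v w))
... | yes found = found
... | no none = contradiction (lookup-ext same) (loc u v u∉D v∉D u≢v)
  where
  same : ∀ w → lookup (N G u ∩ D) w ≡ lookup (N G v ∩ D) w
  same w rewrite lookup-N∩ G D u w | lookup-N∩ G D v w with w ∈? D
  ... | yes w∈D = cong (_∧ lookup D w)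
    (decidable-stable (edge G u w ≟ᵇ edge G v w) λ ne → none (w , w∈D , ne))
  ... | no w∉D rewrite ∉⇒lookup≡false w∉D = trans (∧-zeroʳ _) (sym (∧-zeroʳ _))

dominates×separates⇒ldSet : (G : Graph n) {D : Subset n} →
  Dominates G D → Separates G D → IsLDSet G D
dominates×separates⇒ldSet G {D} dom sep = dom′ , loc′
  where
  dom′ : IsDominating G D
  dom′ u u∉D with w , w∈D , e ← dom u u∉D =
    w , x∈p∩q⁺ (lookup⇒[]= w (N G u) (trans (lookup∘tabulate (edge G u) w) e) , w∈D)

  loc′ : IsLocating G D
  loc′ u v u∉D v∉D u≢v eq with w , w∈D , ne ← sep u v u∉D v∉D u≢v = ne (begin
    edge G u w               ≡⟨ ∧-identityʳ _ ⟨
    edge G u w ∧ true        ≡⟨ cong (edge G u w ∧_) ([]=⇒lookup w∈D) ⟨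
    edge G u w ∧ lookup D w  ≡⟨ lookup-N∩ G D u w ⟨
    lookup (N G u ∩ D) w     ≡⟨ cong (λ p → lookup p w) eq ⟩
    lookup (N G v ∩ D) w     ≡⟨ lookup-N∩ G D v w ⟩
    edge G v w ∧ lookup D w  ≡⟨ cong (edge G v w ∧_) ([]=⇒lookup w∈D) ⟩
    edge G v w ∧ true        ≡⟨ ∧-identityʳ _ ⟩
    edge G v w               ∎)
    where open ≡-Reasoning

-- The vertices `s i` are moved into `D` one by one; injectivity keeps the later ones outside, and
-- each move enlarges the set.
∣p∣+avoiding≤n : ∀ k (D : Subset n) (s : Fin k → Fin n) →
  (∀ {i j} → s i ≡ s j → i ≡ j) → (∀ i → s i ∉ D) → ∣ D ∣ + k ≤ n
∣p∣+avoiding≤n zero D s inj out = subst (_≤ _) (sym (ℕ.+-identityʳ _)) (∣p∣≤n D)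
∣p∣+avoiding≤n (suc k) D s inj out = begin
  ∣ D ∣ + suc k               ≡⟨ ℕ.+-suc ∣ D ∣ k ⟩
  suc ∣ D ∣ + k               ≤⟨ ℕ.+-monoˡ-≤ k (p⊂q⇒∣p∣<∣q∣ D⊂) ⟩
  ∣ D ∪ ⁅ s zero ⁆ ∣ + k      ≤⟨ ∣p∣+avoiding≤n k _ (s ∘ suc) (suc-injective ∘ inj) out′ ⟩
  _                           ∎
  where
  open ℕ.≤-Reasoning
  D⊂ : D ⊂ D ∪ ⁅ s zero ⁆
  D⊂ = p⊆p∪q ⁅ s zero ⁆ , s zero , q⊆p∪q D ⁅ s zero ⁆ (x∈⁅x⁆ _) , out zero

  out′ : ∀ i → s (suc i) ∉ D ∪ ⁅ s zero ⁆
  out′ i ∈∪ with x∈p∪q⁻ D ⁅ s zero ⁆ ∈∪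
  ... | inj₁ ∈D = out (suc i) ∈D
  ... | inj₂ ∈s with () ← inj (x∈⁅y⁆⇒x≡y (s zero) ∈s)

avoiding : ∀ k (D : Subset n) → k + ∣ D ∣ ≤ n → ∃ λ (s : Fin k → Fin n) →
  (∀ {i j} → s i ≡ s j → i ≡ j) × (∀ i → s i ∉ D)
avoiding zero    D le = (λ ()) , (λ { {()} }) , λ ()
avoiding (suc k) [] ()
avoiding (suc k) (inside ∷ D) le
  with s , inj , out ← avoiding (suc k) D
    (s≤s⁻¹ (ℕ.≤-trans (ℕ.≤-reflexive (cong suc (sym (ℕ.+-suc k ∣ D ∣)))) le)) =
  suc ∘ s , inj ∘ suc-injective , λ { i (there i∈) → out i i∈ }
avoiding (suc k) (outside ∷ D) le
  with s , inj , out ← avoiding k D (s≤s⁻¹ le) =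
    (λ { zero → zero ; (suc i) → suc (s i) })
  , (λ { {zero} {zero} _ → refl ; {suc i} {suc j} eq → cong suc (inj (suc-injective eq)) })
  , λ { zero () ; (suc i) (there i∈) → out i i∈ }

removable-injective : (G : Graph n) (s : Vec (Fin n) k) → IsRemovable G s →
  ∀ {i j} → lookup s i ≡ lookup s j → i ≡ j
removable-injective G s (_ , loc) {i} {j} eq = decidable-stable (i ≟ j) λ i≢j →
  let w , _ , ne = loc i j i≢j in ne (cong (λ u → edge G u w) eq)

-- The vertices outside `s` form a locating-dominating set that misses `k` distinct vertices.
removable⇒ldNumber≤ : (G : Graph n) → Removable G k → ldNumber G + k ≤ n
removable⇒ldNumber≤ {n} {k} G (s , rem@(dom , loc)) = begin
  ldNumber G + k  ≤⟨ ℕ.+-monoˡ-≤ k (proj₂ (ldNumber-isLDNumber G) D ld) ⟩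
  ∣ D ∣ + k       ≤⟨ ∣p∣+avoiding≤n k D (lookup s) (removable-injective G s rem) s∉D ⟩
  n               ∎
  where
  open ℕ.≤-Reasoning
  D : Subset n
  D = tabulate (does ∘ outside? s)

  out⇒∈ : ∀ {w} → Outside s w → w ∈ D
  out⇒∈ {w} w∉s = lookup⇒[]= w D (trans (lookup∘tabulate _ w) (dec-true (outside? s w) w∉s))

  s∉D : ∀ i → lookup s i ∉ D
  s∉D i ∈D with () ← trans (sym ([]=⇒lookup ∈D)) (trans (lookup∘tabulate _ (lookup s i))
    (dec-false (outside? s (lookup s i)) (λ out → out i refl)))

  index : ∀ u → u ∉ D → ∃ λ i → lookup s i ≡ u
  index u u∉D with any? (λ i → lookup s i ≟ u)
  ... | yes found = found
  ... | no none = contradiction (out⇒∈ λ i eq → none (i , eq)) u∉D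

  dominates : Dominates G D
  dominates u u∉D with i , refl ← index u u∉D with w , w∉s , e ← dom i = w , out⇒∈ w∉s , e

  separates : Separates G D
  separates u v u∉D v∉D u≢v with i , refl ← index u u∉D | j , refl ← index v v∉D
    with w , w∉s , ne ← loc i j (λ { refl → u≢v refl }) = w , out⇒∈ w∉s , ne

  ld : IsLDSet G D
  ld = dominates×separates⇒ldSet G dominates separates

-- Any `k` vertices outside a minimum locating-dominating set will do: the witnesses lie in that
-- set, hence outside `s`.
ldNumber≤⇒removable : (G : Graph n) → k + ldNumber G ≤ n → Removable G k
ldNumber≤⇒removable {k = k} G le
  with D , ld , ∣D∣ ← proj₁ (ldNumber-isLDNumber G)
  with s , inj , out ← avoiding k D (subst (λ d → k + d ≤ _) (sym ∣D∣) le) = tabulate s , dom , loc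
  where
  ss : ∀ i → lookup (tabulate s) i ≡ s i
  ss = lookup∘tabulate s

  w∉s : ∀ {w} → w ∈ D → Outside (tabulate s) w
  w∉s w∈D j eq = out j (subst (_∈ D) (trans (sym eq) (ss j)) w∈D)

  dom : ∀ i → ∃ λ w → Outside (tabulate s) w × edge G (lookup (tabulate s) i) w ≡ true
  dom i rewrite ss i with w , w∈D , e ← ldSet⇒dominates G ld (s i) (out i) = w , w∉s w∈D , e

  loc : ∀ i j → i ≢ j → ∃ λ w → Outside (tabulate s) w ×
    edge G (lookup (tabulate s) i) w ≢ edge G (lookup (tabulate s) j) w
  loc i j i≢j rewrite ss i | ss j
    with w , w∈D , ne ← ldSet⇒separates G ld (s i) (s j) (out i) (out j) (i≢j ∘ inj) =
    w , w∉s w∈D , ne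

-- Counting traces

members : (D : Subset n) → Fin ∣ D ∣ → Fin n
members (inside  ∷ D) zero    = zero
members (inside  ∷ D) (suc i) = suc (members D i)
members (outside ∷ D) i       = suc (members D i)

∈⇒members : (D : Subset n) {w : Fin n} → w ∈ D → ∃ λ i → members D i ≡ w
∈⇒members (inside  ∷ D) here = zero , refl
∈⇒members (inside  ∷ D) (there w∈D) with i , refl ← ∈⇒members D w∈D = suc i , refl
∈⇒members (outside ∷ D) (there w∈D) with i , refl ← ∈⇒members D w∈D = i , refl

-- Makes a trace a function into `Fin 2`, so that `funToFin` numbers the traces below `2 ^ ∣ D ∣`.
bit : Bool → Fin 2
bit false = 0F
bit true  = 1F

bit-injective : ∀ {a b} → bit a ≡ bit b → a ≡ b
bit-injective {false} {false} _ = refl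
bit-injective {true}  {true}  _ = refl

funToFin-injective : ∀ {m n} {f g : Fin m → Fin n} → funToFin f ≡ funToFin g → ∀ i → f i ≡ g i
funToFin-injective {f = f} {g} eq i = trans (sym (finToFun-funToFin f i))
  (trans (cong (λ x → finToFun x i) eq) (finToFun-funToFin g i))

-- The traces on D of the vertices outside D, together with the empty trace, are
-- distinct subsets of D.
order<ld+2^ld : (G : Graph n) → n < ldNumber G + 2 ^ ldNumber G
order<ld+2^ld {n} G with ldNumber G | ldNumber-isLDNumber G
... | _ | (D , ld , refl) , _ with avoiding (n ∸ ∣ D ∣) D (ℕ.≤-reflexive (ℕ.m∸n+n≡m (∣p∣≤n D)))
... | s , inj , out = begin-strict
  n                      ≡⟨ ℕ.m+[n∸m]≡n (∣p∣≤n D) ⟨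
  -- Strict, because there is one code more than there are vertices outside `D`.
  ∣ D ∣ + (n ∸ ∣ D ∣)    <⟨ ℕ.+-monoʳ-< ∣ D ∣ (injective⇒≤ {f = code} code-injective) ⟩
  ∣ D ∣ + 2 ^ ∣ D ∣      ∎
  where
  open ℕ.≤-Reasoning
  trace : Fin n → Fin ∣ D ∣ → Fin 2
  trace u i = bit (edge G u (members D i))

  code : Fin (suc (n ∸ ∣ D ∣)) → Fin (2 ^ ∣ D ∣)
  code zero    = funToFin {∣ D ∣} (const 0F)
  code (suc i) = funToFin (trace (s i))

  nonempty : ∀ i → (∀ j → 0F ≡ trace (s i) j) → ∀ {A : Set} → A
  nonempty i eq with w , w∈D , e ← ldSet⇒dominates G ld (s i) (out i)
    with j , refl ← ∈⇒members D w∈D with () ← trans (eq j) (cong bit e)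

  code-injective : ∀ {i j} → code i ≡ code j → i ≡ j
  code-injective {zero}  {zero}  eq = refl
  code-injective {zero}  {suc j} eq = nonempty j (funToFin-injective eq)
  code-injective {suc i} {zero}  eq = nonempty i (funToFin-injective (sym eq))
  code-injective {suc i} {suc j} eq = cong suc (decidable-stable (i ≟ j) λ i≢j → distinguish i≢j)
    where
    distinguish : i ≢ j → _
    distinguish i≢j
      with w , w∈D , ne ← ldSet⇒separates G ld (s i) (s j) (out i) (out j) (i≢j ∘ inj)
      with a , refl ← ∈⇒members D w∈D = ne (bit-injective (funToFin-injective eq a))

-- The bound `n < d + 2 ^ d` reads `n < 1` for `d = 0` and `n < 3` for `d = 1`.
2≤ldNumber : (G : Graph n) → 5 ≤ n → 2 ≤ ldNumber G
2≤ldNumber G 5≤n with ldNumber G | order<ld+2^ld G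
... | 0 | lt = contradiction (ℕ.≤-trans 5≤n (ℕ.<⇒≤ lt)) λ { (s≤s ()) }
... | 1 | lt = contradiction (ℕ.≤-trans 5≤n (ℕ.<⇒≤ lt)) λ { (s≤s (s≤s (s≤s ()))) }
... | suc (suc _) | _ = s≤s (s≤s z≤n)

-- Induced paths in doubly-connected graphs

-- Injectivity follows from the edge table: path vertices with equal images would have equal
-- neighbourhoods in `P₄`.
P₄-↪ : (G : Graph n) → ∀ a b c d →
  edge G a b ≡ true → edge G b c ≡ true → edge G c d ≡ true →
  edge G a c ≡ false → edge G a d ≡ false → edge G b d ≡ false → P₄ ↪ G
P₄-↪ G a b c d ab bc cd ac ad bd = record
  { at           = f
  ; at-injective = λ {i} {j} eq → P₄-pointDetermining i j λ k →
      trans (sym (f-edge i k)) (trans (cong (λ u → edge G u (f k)) eq) (f-edge j k))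
  ; at-edge      = f-edge
  }
  where
  f : Fin 4 → Fin _
  f 0F = a
  f 1F = b
  f 2F = c
  f 3F = d

  flip : ∀ {u v β} → edge G u v ≡ β → edge G v u ≡ β
  flip = trans (edge-sym G _ _)

  f-edge : ∀ i j → edge G (f i) (f j) ≡ edge P₄ i j
  f-edge 0F 0F = edge-irrefl G a
  f-edge 0F 1F = ab
  f-edge 0F 2F = ac
  f-edge 0F 3F = ad
  f-edge 1F 0F = flip ab
  f-edge 1F 1F = edge-irrefl G b
  f-edge 1F 2F = bc
  f-edge 1F 3F = bd
  f-edge 2F 0F = flip ac
  f-edge 2F 1F = flip bc
  f-edge 2F 2F = edge-irrefl G c
  f-edge 2F 3F = cd
  f-edge 3F 0F = flip ad
  f-edge 3F 1F = flip bd
  f-edge 3F 2F = flip cd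
  f-edge 3F 3F = edge-irrefl G d

-- β = false makes G disconnected, β = true makes its complement disconnected.
record Split (β : Bool) (G : Graph n) : Set where
  field
    side   : Fin n → Bool
    {x y}  : Fin n
    x-side : side x ≡ true
    y-side : side y ≡ false
    cross  : ∀ u v → side u ≡ true → side v ≡ false → edge G u v ≡ β

open Split

deleteZero : Graph (suc n) → Graph n
deleteZero G = record
  { edge        = λ u v → edge G (suc u) (suc v)
  ; edge-sym    = λ u v → edge-sym G (suc u) (suc v)
  ; edge-irrefl = λ v → edge-irrefl G (suc v)
  }

deleteZero-↪ : (G : Graph (suc n)) → deleteZero G ↪ G
deleteZero-↪ G = record { at = suc ; at-injective = suc-injective ; at-edge = λ _ _ → refl }

cross-≢ : ∀ {β} {G : Graph n} (S : Split β G) → ∀ u v → side S u ≢ side S v → edge G u v ≡ β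
cross-≢ {G = G} S u v u≁v with side S u in su | side S v in sv
... | true  | false = cross S u v su sv
... | false | true  = trans (edge-sym G u v) (cross S v u sv su)
... | true  | true  = contradiction refl u≁v
... | false | false = contradiction refl u≁v

split-complement : ∀ {β} {G : Graph n} → Split β G → Split (not β) (complement G)
split-complement {G = G} S = record
  { side = side S ; x-side = x-side S ; y-side = y-side S
  ; cross = λ u v su sv → trans
      (complement-edge G λ { refl → contradiction (trans (sym su) sv) λ () })
      (cong not (cross S u v su sv)) }

split-resp : ∀ {β} {H G : Graph n} → (∀ u v → edge H u v ≡ edge G u v) → Split β H → Split β G
split-resp H≗G S = record
  { side = side S ; x-side = x-side S ; y-side = y-side S
  ; cross = λ u v su sv → trans (sym (H≗G u v)) (cross S u v su sv) }

-- The complement of 0 - 1 - 2 - 3 is the path 1 - 3 - 0 - 2.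
P₄-↪-complement : P₄ ↪ complement P₄
P₄-↪-complement = P₄-↪ (complement P₄) 1F 3F 0F 2F refl refl refl refl refl refl

P₄↪complement⇒P₄↪ : {G : Graph n} → P₄ ↪ complement G → P₄ ↪ G
P₄↪complement⇒P₄↪ {G = G} φ =
  ↪-trans P₄-↪-complement (↪-trans (complement-↪ φ) (complement²-↪ G))

not-does⁻ : {A : Set} (a? : Dec A) → not (does a?) ≡ false → A
not-does⁻ (yes a) _ = a

¬not-does⁻ : {A : Set} (a? : Dec A) → not (does a?) ≡ true → ¬ A
¬not-does⁻ (no ¬a) _ = ¬a

-- The vertex zero has a neighbour z in one class and a nonneighbour x in the
-- other.  Either some edge y y′ in the class of x joins a neighbour and a
-- nonneighbour of zero, and then z, zero, y, y′ is an induced path, or the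
-- nonneighbours of zero in that class are cut off from all other vertices.
P₄⊎split-extend : (G : Graph (suc n)) (S : Split false (deleteZero G)) → ∀ {z x} →
  edge G zero (suc z) ≡ true → edge G zero (suc x) ≡ false → side S z ≢ side S x →
  P₄ ↪ G ⊎ Split false G
P₄⊎split-extend {n} G S {z} {x} vz vx z≁x = result
  where
  v~ : Fin n → Bool
  v~ u = edge G zero (suc u)

  nearX? : ∀ u → Dec (side S u ≡ side S x)
  nearX? u = side S u ≟ᵇ side S x

  cut? : ∀ u → Dec (side S u ≡ side S x × v~ u ≡ false)
  cut? u = nearX? u ×-dec (v~ u ≟ᵇ false)

  crossing? : Dec (∃₂ λ y y′ → (side S y ≡ side S x × v~ y ≡ true) ×
    (side S y′ ≡ side S x × v~ y′ ≡ false) × edge G (suc y) (suc y′) ≡ true)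
  crossing? = any? λ y → any? λ y′ →
    (nearX? y ×-dec (v~ y ≟ᵇ true)) ×-dec cut? y′ ×-dec (edge G (suc y) (suc y′) ≟ᵇ true)

  far : ∀ {y} → side S y ≡ side S x → edge G (suc z) (suc y) ≡ false
  far {y} sy = cross-≢ S z y λ sz → z≁x (trans sz sy)

  result : P₄ ↪ G ⊎ Split false G
  result with crossing?
  ... | yes (y , y′ , (sy , vy) , (sy′ , vy′) , yy′) =
    inj₁ (P₄-↪ G (suc z) zero (suc y) (suc y′)
      (trans (edge-sym G _ _) vz) vy yy′ (far sy) (far sy′) vy′)
  ... | no none = inj₂ record
    { side = side′ ; x = zero ; y = suc x ; x-side = refl
    ; y-side = cong not (dec-true (cut? x) (refl , vx)) ; cross = cross′ }
    where
    side′ : Fin (suc n) → Bool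
    side′ zero    = true
    side′ (suc u) = not (does (cut? u))

    cross′ : ∀ u w → side′ u ≡ true → side′ w ≡ false → edge G u w ≡ false
    cross′ zero    (suc w) su sw = proj₂ (not-does⁻ (cut? w) sw)
    cross′ (suc u) (suc w) su sw with nw , vw ← not-does⁻ (cut? w) sw = case nearX? u of λ where
      (no  fu) → cross-≢ S u w λ eq → fu (trans eq nw)
      (yes nu) → ¬-not λ uw →
        none (u , w , (nu , ¬-not λ vu → ¬not-does⁻ (cut? u) su (nu , vu)) , (nw , vw) , uw)

-- If vertex zero has no neighbour in one class, it joins the other class. If it is adjacent to all
-- vertices, it is a class of its own in a split of the complement. Otherwise it has a nonneighbour
-- `x` and neighbours in both classes, one of them in the class not containing `x`.
P₄⊎split-step : (G : Graph (suc n)) → Split false (deleteZero G) → P₄ ↪ G ⊎ ∃ λ β → Split β G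
P₄⊎split-step {n} G S with any? (λ u → (side S u ≟ᵇ true) ×-dec (edge G zero (suc u) ≟ᵇ true))
... | no none = inj₂ (false , record
  { side = side′ ; x = suc (x S) ; y = suc (y S) ; x-side = x-side S ; y-side = y-side S
  ; cross = cross′ })
  where
  side′ : Fin (suc n) → Bool
  side′ zero    = false
  side′ (suc u) = side S u

  cross′ : ∀ u w → side′ u ≡ true → side′ w ≡ false → edge G u w ≡ false
  cross′ (suc u) zero su _ = ¬-not λ uv → none (u , su , trans (edge-sym G _ _) uv)
  cross′ (suc u) (suc w) su sw = cross S u w su sw
... | yes (z₁ , sz₁ , vz₁)
  with any? (λ u → (side S u ≟ᵇ false) ×-dec (edge G zero (suc u) ≟ᵇ true))
... | no none = inj₂ (false , record
  { side = side′ ; x = suc (x S) ; y = suc (y S) ; x-side = x-side S ; y-side = y-side S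
  ; cross = cross′ })
  where
  side′ : Fin (suc n) → Bool
  side′ zero    = true
  side′ (suc u) = side S u

  cross′ : ∀ u w → side′ u ≡ true → side′ w ≡ false → edge G u w ≡ false
  cross′ zero (suc w) _ sw = ¬-not λ vw → none (w , sw , vw)
  cross′ (suc u) (suc w) su sw = cross S u w su sw
... | yes (z₂ , sz₂ , vz₂) with any? (λ u → edge G zero (suc u) ≟ᵇ false)
... | no none = inj₂ (true , record
  { side = isZero ; x = zero ; y = suc z₁ ; x-side = refl ; y-side = refl ; cross = cross′ })
  where
  cross′ : ∀ u w → isZero u ≡ true → isZero w ≡ false → edge G u w ≡ true
  cross′ zero (suc w) _ _ = ¬-not λ vw → none (w , vw)
... | yes (x , vx) with side S x in sx
... | true  = Sum.map₂ (false ,_) (P₄⊎split-extend G S vz₂ vx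
  λ eq → contradiction (trans (sym sz₂) (trans eq sx)) λ ())
... | false = Sum.map₂ (false ,_) (P₄⊎split-extend G S vz₁ vx
  λ eq → contradiction (trans (sym sz₁) (trans eq sx)) λ ())

-- Induction on the order, deleting vertex zero; a smaller graph with disconnected complement is
-- treated in `complement G`, as `P₄` is self-complementary. This is the classical fact that a graph
-- of order at least two without induced `P₄` is disconnected or has a disconnected complement.
P₄⊎split : (G : Graph (suc (suc n))) → P₄ ↪ G ⊎ ∃ λ β → Split β G
P₄⊎split {zero} G = inj₂ (edge G 0F 1F , record
  { side = isZero ; x = 0F ; y = 1F ; x-side = refl ; y-side = refl ; cross = cross′ })
  where
  cross′ : ∀ u w → isZero u ≡ true → isZero w ≡ false → edge G u w ≡ edge G 0F 1F
  cross′ 0F 1F _ _ = refl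
P₄⊎split {suc n} G with P₄⊎split (deleteZero G)
... | inj₁ φ = inj₁ (↪-trans φ (deleteZero-↪ G))
... | inj₂ (false , S) = P₄⊎split-step G S
... | inj₂ (true , S)
  with P₄⊎split-step (complement G) (split-resp (λ _ _ → refl) (split-complement S))
... | inj₁ φ = inj₁ (P₄↪complement⇒P₄↪ φ)
... | inj₂ (β , S′) =
  inj₂ (not β , split-resp (at-edge (↪-complement² G)) (split-complement S′))

-- A discrete intermediate value argument along the walk, applied to the sides of a split and to the
-- test `isolated?`.
adj-crossing : {G : Graph n} (c : Fin n → Bool) → ∀ {u v} → Star (Adj G) u v → c u ≢ c v →
  ∃₂ λ x y → edge G x y ≡ true × c x ≢ c y
adj-crossing c ε ne = contradiction refl ne
adj-crossing {G = G} c {u} (_◅_ {j = w} uw p) ne with c u ≟ᵇ c w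
... | no  cu≢cw = u , w , Equivalence.to T-≡ uw , cu≢cw
... | yes cu≡cw = adj-crossing {G = G} c p λ eq → ne (trans cu≡cw eq)

connected⇒¬split : {G : Graph n} → Connected G → ¬ Split false G
connected⇒¬split {G = G} con S
  with u , v , uv , ne ← adj-crossing {G = G} (side S) (con (x S) (y S))
    (λ eq → contradiction (trans (sym (x-side S)) (trans eq (y-side S))) λ ())
  = contradiction (trans (sym uv) (cross-≢ S u v ne)) λ ()

doublyConnected⇒P₄ : (G : Graph (suc (suc n))) → DoublyConnected G → P₄ ↪ G
doublyConnected⇒P₄ G (con , con′) with P₄⊎split G
... | inj₁ φ = φ
... | inj₂ (false , S) = contradiction S (connected⇒¬split {G = G} con)
... | inj₂ (true , S) =
  contradiction (split-complement S) (connected⇒¬split {G = complement G} con′)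

-- Graphs without a removable triple

-- The vertices of the path 0 - 1 - 2 - 3, except t₁ and t₂, are replaced by
-- nonempty independent sets of false twins.
record PathBlowup (t₁ t₂ : Fin 4) (G : Graph n) : Set where
  field
    kind      : Fin n → Fin 4
    rep       : Fin 4 → Fin n
    kind-rep  : ∀ k → kind (rep k) ≡ k
    edge-kind : ∀ u v → edge G u v ≡ edge P₄ (kind u) (kind v)
    thin      : ∀ {u v} → kind u ≡ kind v → kind u ≡ t₁ ⊎ kind u ≡ t₂ → u ≡ v

abstract
  P₄-opposite : ∀ i j → edge P₄ (opposite i) (opposite j) ≡ edge P₄ i j
  P₄-opposite = from-yes (all? λ i → all? λ j → edge P₄ (opposite i) (opposite j) ≟ᵇ edge P₄ i j)

does-≢ : {A B : Set} (a? : Dec A) (b? : Dec B) → does a? ≢ does b? → (A × ¬ B) ⊎ (¬ A × B)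
does-≢ (yes a) (no ¬b) _  = inj₁ (a , ¬b)
does-≢ (no ¬a) (yes b) _  = inj₂ (¬a , b)
does-≢ (yes _) (yes _) ne = contradiction refl ne
does-≢ (no _)  (no _)  ne = contradiction refl ne

module Classification {n : ℕ} {G : Graph n} (φ : P₄ ↪ G)
    (con : Connected G) (¬rem : ¬ Removable G 3) where

  HasKind : Fin n → Fin 4 → Set
  HasKind v k = ∀ i → edge G v (at φ i) ≡ edge P₄ k i

  Isolated : Fin n → Set
  Isolated v = ∀ i → edge G v (at φ i) ≡ false

  hasKind-at : ∀ k → HasKind (at φ k) k
  hasKind-at k i = at-edge φ k i

  inImage? : ∀ v → Dec (∃ λ k → at φ k ≡ v)
  inImage? v = any? λ k → at φ k ≟ v

  type : Fin n → Subset 4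
  type v = tabulate λ i → edge G v (at φ i)

  type-at : ∀ v i → lookup (type v) i ≡ edge G v (at φ i)
  type-at v = lookup∘tabulate λ i → edge G v (at φ i)

  isolated⊎hasKind : ∀ v → Isolated v ⊎ ∃ (HasKind v)
  isolated⊎hasKind v with inImage? v
  ... | yes (k , refl) = inj₂ (k , hasKind-at k)
  ... | no v∉ with P₄-type (type v)
  ... | inj₁ (inj₁ eq) = inj₁ λ i → trans (sym (type-at v i))
    (trans (cong (λ t → lookup t i) eq) (lookup-replicate i false))
  ... | inj₁ (inj₂ (k , eq)) = inj₂ (k , λ i → trans (sym (type-at v i))
    (trans (cong (λ t → lookup t i) eq) (lookup∘tabulate (edge P₄ k) i)))
  ... | inj₂ rem = contradiction (removable-↪ (addVertex-↪ φ v (λ i eq → v∉ (i , eq)) _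
    λ i → sym (type-at v i)) rem) ¬rem

  P₄-nbr : ∀ k → ∃ λ i → edge P₄ k i ≡ true
  P₄-nbr = from-yes (all? λ k → any? λ i → edge P₄ k i ≟ᵇ true)

  isolated⇒≢at : ∀ {v} → Isolated v → ∀ k → at φ k ≢ v
  isolated⇒≢at iso k refl with i , e ← P₄-nbr k =
    contradiction (trans (sym e) (trans (sym (hasKind-at k i)) (iso i))) λ ()

  -- The neighbour `y` is off the path, since `x` sees no path vertex, and it has some kind `k`; the
  -- path, `y` and `x` induce the graph of `P₄-distance2`.
  isolated-nbr : ∀ {x y} → Isolated x → edge G x y ≡ true → ¬ Isolated y → Removable G 3
  isolated-nbr {x} {y} iso xy ¬iso with isolated⊎hasKind y
  ... | inj₁ iso′ = contradiction iso′ ¬iso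
  ... | inj₂ (k , yk) = removable-↪
    (addVertex-↪ (addVertex-↪ φ y y∉ (edge P₄ k) yk) x x∉ isZero xe) (P₄-distance2 k)
    where
    y∉ : ∀ i → at φ i ≢ y
    y∉ i refl = contradiction (trans (sym xy) (iso i)) λ ()

    x∉ : ∀ i → at (addVertex-↪ {G = G} φ y y∉ (edge P₄ k) yk) i ≢ x
    x∉ zero    refl = contradiction (trans (sym xy) (edge-irrefl G x)) λ ()
    x∉ (suc i) = isolated⇒≢at iso i

    xe : ∀ i → edge G x (at (addVertex-↪ {G = G} φ y y∉ (edge P₄ k) yk) i) ≡ isZero i
    xe zero    = xy
    xe (suc i) = iso i

  isolated? : ∀ v → Dec (Isolated v)
  isolated? v = all? λ i → edge G v (at φ i) ≟ᵇ false

  -- A walk from `v` to the path contains an edge between a vertex without path neighbours and a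
  -- vertex with one.
  ¬isolated : ∀ v → ¬ Isolated v
  ¬isolated v iso = ¬rem (found (adj-crossing {G = G} (does ∘ isolated?) (con v (at φ 0F))
      λ eq → contradiction (trans (sym (dec-true (isolated? v) iso))
        (trans eq (dec-false (isolated? (at φ 0F)) λ iso₀ → isolated⇒≢at iso₀ 0F refl))) λ ()))
    where
    found : (∃₂ λ x y → edge G x y ≡ true × does (isolated? x) ≢ does (isolated? y)) → Removable G 3
    found (x , y , xy , ne) with does-≢ (isolated? x) (isolated? y) ne
    ... | inj₁ (ix , ¬iy) = isolated-nbr ix xy ¬iy
    ... | inj₂ (¬ix , iy) = isolated-nbr iy (trans (edge-sym G y x) xy) ¬ix

  abstract
    hasKind : ∀ v → ∃ (HasKind v)
    hasKind v with isolated⊎hasKind v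
    ... | inj₁ iso = contradiction iso (¬isolated v)
    ... | inj₂ k   = k

  kind : Fin n → Fin 4
  kind v = proj₁ (hasKind v)

  kind-at : ∀ k → kind (at φ k) ≡ k
  kind-at k = P₄-pointDetermining _ k λ i →
    trans (sym (proj₂ (hasKind (at φ k)) i)) (hasKind-at k i)

  Extra : Fin n → Set
  Extra v = ∀ k → at φ k ≢ v

  extra-pair : ∀ {u v} → Extra u → Extra v → u ≢ v →
    edge G u v ≡ false × edge P₄ (kind u) (kind v) ≡ false
  extra-pair {u} {v} u∉ v∉ u≢v with P₄-pair (kind u) (kind v) (edge G v u)
  ... | inj₁ (vu , e) = trans (edge-sym G u v) vu , e
  ... | inj₂ rem = contradiction (removable-↪ (addVertex-↪ ψ v v∉′ _ ve) rem) ¬rem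
    where
    ψ : addVertex P₄ (edge P₄ (kind u)) ↪ G
    ψ = addVertex-↪ φ u u∉ (edge P₄ (kind u)) (proj₂ (hasKind u))

    v∉′ : ∀ i → at ψ i ≢ v
    v∉′ zero    = u≢v
    v∉′ (suc i) = v∉ i

    ve : ∀ i → edge G v (at ψ i) ≡ cons (edge G v u) (edge P₄ (kind v)) i
    ve zero    = refl
    ve (suc i) = proj₂ (hasKind v) i

  -- If one vertex is on the path, this is the meaning of the other's kind. For distinct vertices
  -- off the path both sides are false by `extra-pair`; for equal ones both are loops.
  edge-kind : ∀ u v → edge G u v ≡ edge P₄ (kind u) (kind v)
  edge-kind u v with inImage? u | inImage? v
  ... | _ | yes (j , refl) = trans (proj₂ (hasKind u) j) (cong (edge P₄ (kind u)) (sym (kind-at j)))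
  ... | yes (i , refl) | _ = trans (edge-sym G u v) (trans (proj₂ (hasKind v) i)
    (trans (edge-sym P₄ (kind v) i) (cong (λ k → edge P₄ k (kind v)) (sym (kind-at i)))))
  ... | no u∉ | no v∉ with u ≟ v
  ...   | yes refl = trans (edge-irrefl G u) (sym (edge-irrefl P₄ (kind u)))
  ...   | no u≢v with uv , e ← extra-pair (λ k eq → u∉ (k , eq)) (λ k eq → v∉ (k , eq)) u≢v =
    trans uv (sym e)

  Fat : Fin 4 → Set
  Fat k = ∃ λ v → Extra v × kind v ≡ k

  fat? : ∀ k → Dec (Fat k)
  fat? k = any? λ v → (all? λ i → ¬? (at φ i ≟ v)) ×-dec (kind v ≟ k)

  ¬fat-adjacent : ∀ {i j} → Fat i → edge P₄ i j ≡ true → ¬ Fat j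
  ¬fat-adjacent (u , u∉ , refl) e (v , v∉ , refl)
    with u ≟ v
  ... | yes refl = contradiction (trans (sym e) (edge-irrefl P₄ (kind u))) λ ()
  ... | no u≢v = contradiction (trans (sym e) (proj₂ (extra-pair u∉ v∉ u≢v))) λ ()

  ¬fat⇒at : ∀ {k v} → ¬ Fat k → kind v ≡ k → v ≡ at φ k
  ¬fat⇒at {k} {v} ¬fat vk with inImage? v
  ... | no v∉ = contradiction (v , (λ i eq → v∉ (i , eq)) , vk) ¬fat
  ... | yes (i , refl) = cong (at φ) (trans (sym (kind-at i)) vk)

  ¬fat⇒thin : ∀ {i j} → ¬ Fat i → ¬ Fat j → ∀ {u v} →
    kind u ≡ kind v → kind u ≡ i ⊎ kind u ≡ j → u ≡ v
  ¬fat⇒thin ¬i ¬j uv (inj₁ ui) = trans (¬fat⇒at ¬i ui) (sym (¬fat⇒at ¬i (trans (sym uv) ui)))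
  ¬fat⇒thin ¬i ¬j uv (inj₂ uj) = trans (¬fat⇒at ¬j uj) (sym (¬fat⇒at ¬j (trans (sym uv) uj)))

  blowup : ∀ {i j} → ¬ Fat i → ¬ Fat j → PathBlowup i j G
  blowup ¬i ¬j = record
    { kind = kind ; rep = at φ ; kind-rep = kind-at ; edge-kind = edge-kind
    ; thin = ¬fat⇒thin ¬i ¬j }

  -- Fat kinds are nonadjacent on the path. If neither 1 nor 2 is fat, only the ends are blown up.
  -- If 1 is fat, then 0 and 2 are not, and two vertices have kind 1; a fat 2 is the mirror image.
  classification : PathBlowup 1F 2F G ⊎
    ∃ λ (B : PathBlowup 0F 2F G) → ∃₂ λ u v → u ≢ v ×
      PathBlowup.kind B u ≡ 1F × PathBlowup.kind B v ≡ 1F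
  classification with fat? 1F
  ... | yes f@(u , u∉ , u1) =
    inj₂ (blowup (¬fat-adjacent f refl) (¬fat-adjacent f refl)
      , at φ 1F , u , u∉ 1F , kind-at 1F , u1)
  ... | no ¬f₁ with fat? 2F
  ... | no ¬f₂ = inj₁ (blowup ¬f₁ ¬f₂)
  -- The path is read backwards, which turns the thin kinds 1 and 3 into 2 and 0.
  ... | yes f@(u , u∉ , u2) = inj₂ (record
    { kind      = opposite ∘ kind
    ; rep       = at φ ∘ opposite
    ; kind-rep  = λ k → trans (cong opposite (kind-at (opposite k))) (opposite-involutive k)
    ; edge-kind = λ x y → trans (edge-kind x y) (sym (P₄-opposite (kind x) (kind y)))
    ; thin      = λ {x} {y} xy t → ¬fat⇒thin (¬fat-adjacent f refl) (¬fat-adjacent f refl)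
        (trans (sym (opposite-involutive _)) (trans (cong opposite xy) (opposite-involutive _)))
        (Sum.map (λ e → trans (sym (opposite-involutive _)) (cong opposite e))
                 (λ e → trans (sym (opposite-involutive _)) (cong opposite e)) t) }
    , at φ 2F , u , u∉ 2F , cong opposite (kind-at 2F) , cong opposite u2)

-- Removable sets in blow-ups

blowup-rep : ∀ {t₁ t₂} {G : Graph n} (B : PathBlowup t₁ t₂ G) → P₄ ↪ G
blowup-rep {G = G} B = record
  { at = rep
  ; at-injective = λ {i} {j} eq → trans (sym (kind-rep i)) (trans (cong kind eq) (kind-rep j))
  ; at-edge = λ i j → trans (edge-kind (rep i) (rep j))
      (cong₂ (edge P₄) (kind-rep i) (kind-rep j)) }
  where open PathBlowup B

-- The trace of a removable vector when only kinds are recorded, with `E` equal to `id` for the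
-- graph and `not` for its complement. Being a condition on vectors over `Fin 4`, it reduces
-- nonremovability in blow-ups of every order to a finite check.
KindRemovable : Fin 4 → Fin 4 → (Bool → Bool) → Vec (Fin 4) k → Set
KindRemovable t₁ t₂ E κ =
  (∀ i → ∃ λ k → Unused k × E (edge P₄ (lookup κ i) k) ≡ true) ×
  (∀ i j → i ≢ j → ∃ λ k → Unused k × E (edge P₄ (lookup κ i) k) ≢ E (edge P₄ (lookup κ j) k))
  where
  -- A vertex of kind k can lie outside a set of vertices with kinds κ.
  Unused : Fin 4 → Set
  Unused k = ∀ i → lookup κ i ≡ k → ¬ (k ≡ t₁ ⊎ k ≡ t₂)

kindRemovable? : ∀ t₁ t₂ E → Decidable (KindRemovable {k} t₁ t₂ E)
kindRemovable? t₁ t₂ E κ =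
  all? (λ i → any? λ k → unused? k ×-dec (E (edge P₄ (lookup κ i) k) ≟ᵇ true)) ×-dec
  all? (λ i → all? λ j → ¬? (i ≟ j) →-dec any? λ k → unused? k ×-dec
    ¬? (E (edge P₄ (lookup κ i) k) ≟ᵇ E (edge P₄ (lookup κ j) k)))
  where
  unused? : ∀ k → Dec (∀ i → lookup κ i ≡ k → ¬ (k ≡ t₁ ⊎ k ≡ t₂))
  unused? k = all? λ i → (lookup κ i ≟ k) →-dec ¬? ((k ≟ t₁) ⊎-dec (k ≟ t₂))

-- Each witness is replaced by its kind. It lies outside `s`, so it differs from the entries it is
-- compared with and the rule for `G′` applies; and a thin kind occurring in `s` has no second
-- vertex to act as witness.
removable⇒kindRemovable : ∀ {t₁ t₂} {G : Graph n} (B : PathBlowup t₁ t₂ G) (G′ : Graph n) E →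
  (∀ {u v} → u ≢ v → edge G′ u v ≡ E (edge G u v)) → ∀ {k} →
  Removable G′ k → ∃ λ (κ : Vec (Fin 4) k) → KindRemovable t₁ t₂ E κ
removable⇒kindRemovable {n} {t₁} {t₂} {G} B G′ E G′-edge {k} (s , dom , loc) = κ , dom′ , loc′
  where
  open PathBlowup B
  κ : Vec (Fin 4) k
  κ = map kind s

  κs : ∀ i → lookup κ i ≡ kind (lookup s i)
  κs i = lookup-map i kind s

  unused : ∀ {w} → Outside s w → ∀ i → lookup κ i ≡ kind w → ¬ (kind w ≡ t₁ ⊎ kind w ≡ t₂)
  unused w∉s i eq t = w∉s i (sym (thin (trans (sym eq) (κs i)) t))

  κ-edge : ∀ i {w} → Outside s w → E (edge P₄ (lookup κ i) (kind w)) ≡ edge G′ (lookup s i) w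
  κ-edge i {w} w∉s = trans (cong (λ x → E (edge P₄ x (kind w))) (κs i))
    (trans (cong E (sym (edge-kind _ w))) (sym (G′-edge (w∉s i))))

  dom′ : ∀ i → ∃ λ k → _ × E (edge P₄ (lookup κ i) k) ≡ true
  dom′ i with w , w∉s , e ← dom i = kind w , unused w∉s , trans (κ-edge i w∉s) e

  loc′ : ∀ i j → i ≢ j → ∃ λ k → _ × E (edge P₄ (lookup κ i) k) ≢ E (edge P₄ (lookup κ j) k)
  loc′ i j i≢j with w , w∉s , ne ← loc i j i≢j = kind w , unused w∉s , λ eq →
    ne (trans (sym (κ-edge i w∉s)) (trans eq (κ-edge j w∉s)))

-- The fibres at 1 and 2 are singletons in a double star, those at 0 and 2 in K^s_{1,r}.
Extremal : Fin 4 → Fin 4 → Set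
Extremal t₁ t₂ = (t₁ ≡ 1F × t₂ ≡ 2F) ⊎ (t₁ ≡ 0F × t₂ ≡ 2F)

extremal? : ∀ t₁ t₂ → Dec (Extremal t₁ t₂)
extremal? t₁ t₂ = ((t₁ ≟ 1F) ×-dec (t₂ ≟ 2F)) ⊎-dec ((t₁ ≟ 0F) ×-dec (t₂ ≟ 2F))

abstract
  ¬kindRemovable₃ : ∀ t₁ t₂ → Extremal t₁ t₂ → (κ : Vec (Fin 4) 3) → ¬ KindRemovable t₁ t₂ id κ
  ¬kindRemovable₃ = from-yes (all? λ t₁ → all? λ t₂ → extremal? t₁ t₂ →-dec
    allVec? 3 λ κ → ¬? (kindRemovable? t₁ t₂ id κ))

abstract
  ¬kindRemovable₄ : ∀ t₁ t₂ → Extremal t₁ t₂ → (κ : Vec (Fin 4) 4) → ¬ KindRemovable t₁ t₂ not κ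
  ¬kindRemovable₄ = from-yes (all? λ t₁ → all? λ t₂ → extremal? t₁ t₂ →-dec
    allVec? 4 λ κ → ¬? (kindRemovable? t₁ t₂ not κ))

abstract
  -- The graph is `P₄` with a false twin of `k` added, the least blow-up beyond the path itself.
  complement-twin-removable : ∀ t₁ t₂ → Extremal t₁ t₂ → ∀ k → ¬ (k ≡ t₁ ⊎ k ≡ t₂) →
    Removable (complement (addVertex P₄ (edge P₄ k))) 3
  complement-twin-removable = from-yes (all? λ t₁ → all? λ t₂ → extremal? t₁ t₂ →-dec
    all? λ k → ¬? ((k ≟ t₁) ⊎-dec (k ≟ t₂)) →-dec
    removable? (complement (addVertex P₄ (edge P₄ k))) 3)

∃-outside : m < n → (f : Fin m → Fin n) → ∃ λ v → ∀ i → f i ≢ v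
∃-outside {m} {n} m<n f with any? (λ v → all? λ i → ¬? (f i ≟ v))
... | yes found = found
... | no none = contradiction (injective⇒≤ {f = preimage} λ {u} {v} eq →
    trans (sym (proj₂ (surj u))) (trans (cong f eq) (proj₂ (surj v)))) (ℕ.<⇒≱ m<n)
  where
  surj : ∀ v → ∃ λ i → f i ≡ v
  surj v = decidable-stable (any? λ i → f i ≟ v) λ ¬i → none (v , λ i eq → ¬i (i , eq))

  preimage : Fin n → Fin m
  preimage v = proj₁ (surj v)

module Extremality {t₁ t₂ : Fin 4} (ext : Extremal t₁ t₂) {n : ℕ} {G : Graph n}
    (B : PathBlowup t₁ t₂ G) where
  open PathBlowup B

  ¬removable₃ : ¬ Removable G 3
  ¬removable₃ rem with κ , rem′ ← removable⇒kindRemovable B G id (λ _ → refl) rem =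
    ¬kindRemovable₃ t₁ t₂ ext κ rem′

  ¬complement-removable₄ : ¬ Removable (complement G) 4
  ¬complement-removable₄ rem
    with κ , rem′ ← removable⇒kindRemovable B (complement G) not (complement-edge G) rem =
    ¬kindRemovable₄ t₁ t₂ ext κ rem′

  -- Some `v` is not a representative, so its kind is not thin; together with the representatives it
  -- induces `P₄` with a twin added.
  complement-removable₃ : 5 ≤ n → Removable (complement G) 3
  complement-removable₃ 5≤n with v , v∉ ← ∃-outside 5≤n rep =
    removable-↪ (complement-↪ (addVertex-↪ (blowup-rep B) v v∉ (edge P₄ (kind v)) λ i →
      trans (edge-kind v (rep i)) (cong (edge P₄ (kind v)) (kind-rep i))))
      (complement-twin-removable t₁ t₂ ext (kind v) λ t →
        v∉ (kind v) (sym (thin (sym (kind-rep (kind v))) t)))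

-- Isomorphisms of blow-ups

count : (Fin n → Fin k) → Fin k → ℕ
count {zero}  κ i = 0
count {suc n} κ i = (if does (κ zero ≟ i) then 1 else 0) + count (κ ∘ suc) i

count-cong : {κ κ′ : Fin n → Fin k} → (∀ u → κ u ≡ κ′ u) → ∀ i → count κ i ≡ count κ′ i
count-cong {zero}  eq i = refl
count-cong {suc n} eq i =
  cong₂ _+_ (cong (λ x → if does (x ≟ i) then 1 else 0) (eq zero)) (count-cong (eq ∘ suc) i)

count-positive : (κ : Fin n → Fin k) → ∀ {i} → 0 < count κ i → ∃ λ u → κ u ≡ i
count-positive {suc n} κ {i} 0<c with κ zero ≟ i
... | yes eq = zero , eq
... | no _ with u , eq ← count-positive (κ ∘ suc) 0<c = suc u , eq

count-punchIn : (κ : Fin (suc n) → Fin k) → ∀ x i →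
  count κ i ≡ (if does (κ x ≟ i) then 1 else 0) + count (κ ∘ punchIn x) i
count-punchIn κ zero i = refl
count-punchIn {suc n} κ (suc x) i = begin
  a + count (κ ∘ suc) i                      ≡⟨ cong (a +_) (count-punchIn (κ ∘ suc) x i) ⟩
  a + (b + c)                                ≡⟨ ℕ.+-assoc a b c ⟨
  a + b + c                                  ≡⟨ cong (_+ c) (ℕ.+-comm a b) ⟩
  b + a + c                                  ≡⟨ ℕ.+-assoc b a c ⟩
  b + (a + c)                                ∎
  where
  open ≡-Reasoning
  a = if does (κ zero ≟ i) then 1 else 0
  b = if does (κ (suc x) ≟ i) then 1 else 0
  c = count (κ ∘ suc ∘ punchIn x) i

count-at : (κ : Fin (suc n) → Fin k) → ∀ x → count κ (κ x) ≡ suc (count (κ ∘ punchIn x) (κ x))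
count-at κ x = trans (count-punchIn κ x (κ x))
  (cong (λ b → (if b then 1 else 0) + count (κ ∘ punchIn x) (κ x)) (dec-true (κ x ≟ κ x) refl))

0<count : (κ : Fin n → Fin k) → ∀ x → 0 < count κ (κ x)
0<count {suc n} κ x = subst (0 <_) (sym (count-at κ x)) (s≤s z≤n)

2≤count : (κ : Fin n → Fin k) → ∀ {x y} → x ≢ y → κ x ≡ κ y → 2 ≤ count κ (κ x)
2≤count {suc n} κ {x} {y} x≢y eq = subst (2 ≤_) (sym (count-at κ x)) (s≤s
  (subst (λ i → 0 < count (κ ∘ punchIn x) i)
    (trans (cong κ (punchIn-punchOut x≢y)) (sym eq))
    (0<count (κ ∘ punchIn x) (punchOut x≢y))))

count-unique : (κ : Fin n → Fin k) → ∀ x → (∀ y → κ y ≡ κ x → y ≡ x) → count κ (κ x) ≡ 1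
count-unique {suc n} κ x unique with count (κ ∘ punchIn x) (κ x) in eq
... | zero  = trans (count-at κ x) (cong suc eq)
... | suc c with y , κy ← count-positive (κ ∘ punchIn x) (subst (0 <_) (sym eq) (s≤s z≤n)) =
  contradiction (unique _ κy) (punchInᵢ≢i x y)

-- Vertex zero is matched with some `x` of the same colour. Deleting both keeps the counts equal,
-- and `insert` extends the bijection of the rest.
equal-counts⇒↔ : (κ : Fin m → Fin k) (κ′ : Fin n → Fin k) → (∀ i → count κ i ≡ count κ′ i) →
  Σ[ f ∈ Fin m ↔ Fin n ] (∀ u → κ u ≡ κ′ (Inverse.to f u))
equal-counts⇒↔ {zero} {n = zero} κ κ′ eq = Permutation.id , λ ()
equal-counts⇒↔ {zero} {n = suc n} κ κ′ eq =
  contradiction (trans (eq (κ′ zero)) (count-at κ′ zero)) λ ()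
equal-counts⇒↔ {suc m} {n = n} κ κ′ eq
  with x , κ′x ← count-positive κ′ (subst (0 <_) (eq (κ zero)) (0<count κ zero))
  with suc n ← n
  with f , κf ← equal-counts⇒↔ (κ ∘ suc) (κ′ ∘ punchIn x) (λ i → ℕ.+-cancelˡ-≡ _ _ _
    (trans (eq i) (trans (count-punchIn κ′ x i)
      (cong (λ j → (if does (j ≟ i) then 1 else 0) + count (κ′ ∘ punchIn x) i) κ′x)))) =
  insert zero x f , λ where
    zero    → sym κ′x
    (suc u) → trans (κf u) (cong κ′ (sym (insert-punchIn zero x f u)))

count-const-≡ : (i : Fin k) → count {n} (const i) i ≡ n
count-const-≡ {n = zero}  i = refl
count-const-≡ {n = suc n} i rewrite dec-true (i ≟ i) refl = cong suc (count-const-≡ i)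

count-const-≢ : {i j : Fin k} → i ≢ j → count {n} (const i) j ≡ 0
count-const-≢ {n = zero}  i≢j = refl
count-const-≢ {n = suc n} {i} {j} i≢j rewrite dec-false (i ≟ j) i≢j = count-const-≢ {n = n} i≢j

count-splitAt : ∀ m (κ : Fin m → Fin k) (κ′ : Fin n → Fin k) → ∀ i →
  count ([ κ , κ′ ] ∘ splitAt m) i ≡ count κ i + count κ′ i
count-splitAt zero    κ κ′ i = refl
count-splitAt (suc m) κ κ′ i = trans
  (cong (a +_) (trans (count-cong (λ u → map-suc (splitAt m u)) i)
    (count-splitAt m (κ ∘ suc) κ′ i)))
  (sym (ℕ.+-assoc a _ _))
  where
  a = if does (κ zero ≟ i) then 1 else 0
  map-suc : ∀ s → [ κ , κ′ ] (Sum.map suc (λ z → z) s) ≡ [ κ ∘ suc , κ′ ] s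
  map-suc (inj₁ _) = refl
  map-suc (inj₂ _) = refl

blowup-≅ : ∀ {t₁ t₂} {G : Graph m} {H : Graph n} (B : PathBlowup t₁ t₂ G) (κ : Fin n → Fin 4) →
  (∀ u v → edge H u v ≡ edge P₄ (κ u) (κ v)) →
  (∀ i → count (PathBlowup.kind B) i ≡ count κ i) → G ≅ H
blowup-≅ B κ H-edge counts with f , κf ← equal-counts⇒↔ (PathBlowup.kind B) κ counts =
  f , λ u v → trans (PathBlowup.edge-kind B u v)
    (trans (cong₂ (edge P₄) (κf u) (κf v)) (sym (H-edge _ _)))

blowup-resp-≅ : ∀ {t₁ t₂} {G : Graph m} {H : Graph n} → G ≅ H →
  PathBlowup t₁ t₂ H → PathBlowup t₁ t₂ G
blowup-resp-≅ (f , e) B = record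
  { kind      = kind ∘ to
  ; rep       = from ∘ rep
  ; kind-rep  = λ k → trans (cong kind (strictlyInverseˡ (rep k))) (kind-rep k)
  ; edge-kind = λ u v → trans (e u v) (edge-kind _ _)
  ; thin      = λ eq t → Injection.injective (↔⇒↣ f) (thin eq t)
  }
  where
  open PathBlowup B
  open Inverse f using (to; from; strictlyInverseˡ)

-- Double stars and `K^s_{1,r}` as blow-ups

doubleStar-kind⊎ : ∀ r s → Fin (suc r) ⊎ Fin (suc s) → Fin 4
doubleStar-kind⊎ r s = [ cons 1F (const 0F) , cons 2F (const 3F) ]

-- The path runs from leaves through the two centres to leaves.
doubleStar-kind : ∀ r s → Fin (suc r + suc s) → Fin 4
doubleStar-kind r s = doubleStar-kind⊎ r s ∘ splitAt (suc r)

doubleStar-edge : ∀ r s u v → edge (doubleStar r s) u v ≡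
  edge P₄ (doubleStar-kind r s u) (doubleStar-kind r s v)
doubleStar-edge r s u v with splitAt (suc r) u | splitAt (suc r) v
... | inj₁ zero    | inj₁ zero    = refl
... | inj₁ zero    | inj₁ (suc _) = refl
... | inj₁ (suc _) | inj₁ zero    = refl
... | inj₁ (suc _) | inj₁ (suc _) = refl
... | inj₁ zero    | inj₂ zero    = refl
... | inj₁ zero    | inj₂ (suc _) = refl
... | inj₁ (suc _) | inj₂ zero    = refl
... | inj₁ (suc _) | inj₂ (suc _) = refl
... | inj₂ zero    | inj₁ zero    = refl
... | inj₂ zero    | inj₁ (suc _) = refl
... | inj₂ (suc _) | inj₁ zero    = refl
... | inj₂ (suc _) | inj₁ (suc _) = refl
... | inj₂ zero    | inj₂ zero    = refl
... | inj₂ zero    | inj₂ (suc _) = refl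
... | inj₂ (suc _) | inj₂ zero    = refl
... | inj₂ (suc _) | inj₂ (suc _) = refl

doubleStar-blowup : ∀ {r s} → 1 ≤ r → 1 ≤ s → PathBlowup 1F 2F (doubleStar r s)
doubleStar-blowup {suc r} {suc s} _ _ = record
  { kind = doubleStar-kind (suc r) (suc s) ; rep = rep ; kind-rep = kind-rep
  ; edge-kind = doubleStar-edge (suc r) (suc s)
  ; thin = λ {u} {v} eq t → trans (sym (join-splitAt (suc (suc r)) (suc (suc s)) u))
      (trans (cong (join (suc (suc r)) (suc (suc s))) (thin⊎ (splitAt _ u) (splitAt _ v) eq t))
        (join-splitAt (suc (suc r)) (suc (suc s)) v)) }
  where
  rep : Fin 4 → Fin (suc (suc r) + suc (suc s))
  rep 0F = 1F ↑ˡ suc (suc s)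
  rep 1F = 0F
  rep 2F = suc (suc r) ↑ʳ 0F
  rep 3F = suc (suc r) ↑ʳ 1F

  kind-rep : ∀ k → doubleStar-kind (suc r) (suc s) (rep k) ≡ k
  kind-rep 0F = refl
  kind-rep 1F = refl
  kind-rep 2F = cong (doubleStar-kind⊎ (suc r) (suc s)) (splitAt-↑ʳ (suc (suc r)) (suc (suc s)) 0F)
  kind-rep 3F = cong (doubleStar-kind⊎ (suc r) (suc s)) (splitAt-↑ʳ (suc (suc r)) (suc (suc s)) 1F)

  thin⊎ : ∀ x y → let k = doubleStar-kind⊎ (suc r) (suc s) in
    k x ≡ k y → k x ≡ 1F ⊎ k x ≡ 2F → x ≡ y
  thin⊎ (inj₁ zero) (inj₁ zero)    eq t = refl
  thin⊎ (inj₂ zero) (inj₂ zero)    eq t = refl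
  thin⊎ (inj₁ zero) (inj₁ (suc _)) ()
  thin⊎ (inj₁ zero) (inj₂ zero) ()
  thin⊎ (inj₁ zero) (inj₂ (suc _)) ()
  thin⊎ (inj₂ zero) (inj₂ (suc _)) ()
  thin⊎ (inj₂ zero) (inj₁ zero) ()
  thin⊎ (inj₂ zero) (inj₁ (suc _)) ()
  thin⊎ (inj₁ (suc _)) _ eq (inj₁ ())
  thin⊎ (inj₁ (suc _)) _ eq (inj₂ ())
  thin⊎ (inj₂ (suc _)) _ eq (inj₁ ())
  thin⊎ (inj₂ (suc _)) _ eq (inj₂ ())

doubleStar-count : ∀ r s i → count (doubleStar-kind r s) i ≡ lookup (r ∷ 1 ∷ 1 ∷ s ∷ []) i
doubleStar-count r s i = trans (count-splitAt (suc r) _ _ i) (sides i)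
  where
  sides : ∀ i → count {suc r} (cons 1F (const 0F)) i + count {suc s} (cons 2F (const 3F)) i ≡
    lookup (r ∷ 1 ∷ 1 ∷ s ∷ []) i
  sides 0F = trans
    (cong₂ _+_ (count-const-≡ {n = r} 0F) (count-const-≢ {n = s} {3F} {0F} λ ()))
    (ℕ.+-identityʳ r)
  sides 1F = cong₂ (λ x y → suc x + y) (count-const-≢ {n = r} {0F} {1F} λ ())
    (count-const-≢ {n = s} {3F} {1F} λ ())
  sides 2F = cong₂ (λ x y → x + suc y) (count-const-≢ {n = r} {0F} {2F} λ ())
    (count-const-≢ {n = s} {3F} {2F} λ ())
  sides 3F = cong₂ _+_ (count-const-≢ {n = r} {0F} {3F} λ ()) (count-const-≡ {n = s} 3F)

-- The path runs from the new vertex through the chosen leaves and the centre to the other leaves.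
starPlus-kind : ∀ r s → Fin (suc (suc r)) → Fin 4
starPlus-kind r s zero = 0F
starPlus-kind r s (suc zero) = 2F
starPlus-kind r s (suc (suc i)) = if toℕ i <ᵇ s then 1F else 3F

starPlus-edge : ∀ r s u v → edge (starPlus r s) u v ≡
  edge P₄ (starPlus-kind r s u) (starPlus-kind r s v)
starPlus-edge r s zero zero = refl
starPlus-edge r s zero (suc zero) = refl
starPlus-edge r s (suc zero) zero = refl
starPlus-edge r s (suc zero) (suc zero) = refl
starPlus-edge r s zero (suc (suc j)) with toℕ j <ᵇ s
... | true = refl
... | false = refl
starPlus-edge r s (suc zero) (suc (suc j)) with toℕ j <ᵇ s
... | true = refl
... | false = refl
starPlus-edge r s (suc (suc i)) zero with toℕ i <ᵇ s
... | true = refl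
... | false = refl
starPlus-edge r s (suc (suc i)) (suc zero) with toℕ i <ᵇ s
... | true = refl
... | false = refl
starPlus-edge r s (suc (suc i)) (suc (suc j)) with toℕ i <ᵇ s | toℕ j <ᵇ s
... | true  | true  = refl
... | true  | false = refl
... | false | true  = refl
... | false | false = refl

n<ᵇn≡false : ∀ n → (n <ᵇ n) ≡ false
n<ᵇn≡false zero    = refl
n<ᵇn≡false (suc n) = n<ᵇn≡false n

starPlus-blowup : ∀ {r s} → 2 ≤ s → s ≤ r ∸ 1 → PathBlowup 0F 2F (starPlus r s)
starPlus-blowup {zero} {suc s} _ ()
starPlus-blowup {suc r} {suc s} _ s≤r = record
  { kind = starPlus-kind (suc r) (suc s) ; rep = rep ; kind-rep = kind-rep
  ; edge-kind = starPlus-edge (suc r) (suc s) ; thin = λ {u} {v} → thin u v }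
  where
  rep : Fin 4 → Fin (suc (suc (suc r)))
  rep 0F = 0F
  rep 1F = 2F
  rep 2F = 1F
  -- The first leaf that is not chosen has index `suc s`; it exists by `s≤r`.
  rep 3F = suc (suc (fromℕ< (s≤s s≤r)))

  kind-rep : ∀ k → starPlus-kind (suc r) (suc s) (rep k) ≡ k
  kind-rep 0F = refl
  kind-rep 1F = refl
  kind-rep 2F = refl
  kind-rep 3F = cong (λ b → if b then 1F else 3F)
    (trans (cong (_<ᵇ suc s) (toℕ-fromℕ< (s≤s s≤r))) (n<ᵇn≡false s))

  thin : ∀ u v → let κ = starPlus-kind (suc r) (suc s) in κ u ≡ κ v → κ u ≡ 0F ⊎ κ u ≡ 2F → u ≡ v
  thin zero       zero       _ _ = refl
  thin (suc zero) (suc zero) _ _ = refl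
  thin zero       (suc zero) ()
  thin (suc zero) zero       ()
  thin zero (suc (suc j)) eq t with toℕ j <ᵇ suc s
  thin zero (suc (suc j)) () t | true
  thin zero (suc (suc j)) () t | false
  thin (suc zero) (suc (suc j)) eq t with toℕ j <ᵇ suc s
  thin (suc zero) (suc (suc j)) () t | true
  thin (suc zero) (suc (suc j)) () t | false
  thin (suc (suc i)) v eq t with toℕ i <ᵇ suc s
  thin (suc (suc i)) v eq (inj₁ ()) | true
  thin (suc (suc i)) v eq (inj₂ ()) | true
  thin (suc (suc i)) v eq (inj₁ ()) | false
  thin (suc (suc i)) v eq (inj₂ ()) | false

-- With `s + t` leaves, recursion on `s` removes one chosen leaf at a time and ends at a constant
-- colouring.
starPlus-leaves : ∀ s t i → count {s + t} (λ u → if toℕ u <ᵇ s then 1F else 3F) i ≡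
  lookup (0 ∷ s ∷ 0 ∷ t ∷ []) i
starPlus-leaves zero t 0F = count-const-≢ {n = t} {3F} {0F} λ ()
starPlus-leaves zero t 1F = count-const-≢ {n = t} {3F} {1F} λ ()
starPlus-leaves zero t 2F = count-const-≢ {n = t} {3F} {2F} λ ()
starPlus-leaves zero t 3F = count-const-≡ {n = t} 3F
starPlus-leaves (suc s) t 0F = starPlus-leaves s t 0F
starPlus-leaves (suc s) t 1F = cong suc (starPlus-leaves s t 1F)
starPlus-leaves (suc s) t 2F = starPlus-leaves s t 2F
starPlus-leaves (suc s) t 3F = starPlus-leaves s t 3F

starPlus-count : ∀ s t i → count (starPlus-kind (s + t) s) i ≡ lookup (1 ∷ s ∷ 1 ∷ t ∷ []) i
starPlus-count s t 0F = cong suc (starPlus-leaves s t 0F)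
starPlus-count s t 1F = starPlus-leaves s t 1F
starPlus-count s t 2F = cong suc (starPlus-leaves s t 2F)
starPlus-count s t 3F = starPlus-leaves s t 3F

module _ {t₁ t₂ : Fin 4} {n : ℕ} {G : Graph n} (B : PathBlowup t₁ t₂ G) where
  open PathBlowup B

  0<count-kind : ∀ k → 0 < count kind k
  0<count-kind k = subst (λ k → 0 < count kind k) (kind-rep k) (0<count kind (rep k))

  count-thin : ∀ k → k ≡ t₁ ⊎ k ≡ t₂ → count kind k ≡ 1
  count-thin k t = subst (λ k → count kind k ≡ 1) (kind-rep k)
    (count-unique kind (rep k) λ y eq →
      sym (thin (sym eq) (subst (λ k → k ≡ t₁ ⊎ k ≡ t₂) (sym (kind-rep k)) t)))

IsDoubleStar : Graph n → Set
IsDoubleStar G = ∃₂ λ r s → 1 ≤ r × 1 ≤ s × (G ≅ doubleStar r s)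

IsStarPlus : Graph n → Set
IsStarPlus G = ∃₂ λ r s → 2 ≤ s × s ≤ r ∸ 1 × (G ≅ starPlus r s)

blowup⇒doubleStar : {G : Graph n} → PathBlowup 1F 2F G → IsDoubleStar G
blowup⇒doubleStar B = c 0F , c 3F , 0<count-kind B 0F , 0<count-kind B 3F ,
  blowup-≅ {H = doubleStar (c 0F) (c 3F)} B
    (doubleStar-kind (c 0F) (c 3F)) (doubleStar-edge (c 0F) (c 3F))
    λ i → trans (counts i) (sym (doubleStar-count (c 0F) (c 3F) i))
  where
  c : Fin 4 → ℕ
  c = count (PathBlowup.kind B)
  counts : ∀ i → c i ≡ lookup (c 0F ∷ 1 ∷ 1 ∷ c 3F ∷ []) i
  counts 0F = refl
  counts 1F = count-thin B 1F (inj₁ refl)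
  counts 2F = count-thin B 2F (inj₂ refl)
  counts 3F = refl

-- The chosen leaves are the fibre over 1, the other leaves the fibre over 3; `u` and `v` ensure
-- that at least two are chosen.
blowup⇒starPlus : {G : Graph n} (B : PathBlowup 0F 2F G) → ∀ {u v} → u ≢ v →
  PathBlowup.kind B u ≡ 1F → PathBlowup.kind B v ≡ 1F → IsStarPlus G
blowup⇒starPlus B {u} {v} u≢v ku kv = s + t , s ,
  subst (λ k → 2 ≤ count kind k) ku (2≤count kind u≢v (trans ku (sym kv))) ,
  s≤ ,
  blowup-≅ {H = starPlus (s + t) s} B (starPlus-kind (s + t) s) (starPlus-edge (s + t) s)
    λ i → trans (counts i) (sym (starPlus-count s t i))
  where
  open PathBlowup B using (kind)
  s t : ℕ
  s = count kind 1F
  t = count kind 3F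

  s≤ : s ≤ s + t ∸ 1
  -- Kind 3 is represented, so `t` is positive and the truncated subtraction is exact.
  s≤ = subst (s ≤_) (sym (ℕ.+-∸-assoc s (0<count-kind B 3F))) (ℕ.m≤m+n s (t ∸ 1))

  counts : ∀ i → count kind i ≡ lookup (1 ∷ s ∷ 1 ∷ t ∷ []) i
  counts 0F = count-thin B 0F (inj₁ refl)
  counts 1F = refl
  counts 2F = count-thin B 2F (inj₂ refl)
  counts 3F = refl

-- Bounds and equality cases

≅⇒↪ : {G : Graph m} {H : Graph n} → G ≅ H → G ↪ H
≅⇒↪ (f , e) = record
  { at = Inverse.to f ; at-injective = Injection.injective (↔⇒↣ f) ; at-edge = λ i j → sym (e i j) }

-- A missed vertex would extend `φ` to an embedding of a graph of order `n + 1` into one of order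
-- `n`.
↪-surjective : {H G : Graph n} (φ : H ↪ G) → ∀ v → ∃ λ i → at φ i ≡ v
↪-surjective {G = G} φ v with any? (λ i → at φ i ≟ v)
... | yes found = found
... | no v∉ = contradiction (injective⇒≤ (at-injective φ⁺)) ℕ.1+n≰n
  where
  φ⁺ = addVertex-↪ φ v (λ i eq → v∉ (i , eq)) (λ i → edge G v (at φ i)) λ _ → refl

↪⇒≅ : {H G : Graph n} → H ↪ G → H ≅ G
↪⇒≅ φ = mk↔ₛ′ (at φ) (proj₁ ∘ ↪-surjective φ) (proj₂ ∘ ↪-surjective φ)
    (λ i → at-injective φ (proj₂ (↪-surjective φ (at φ i))))
  , λ u v → sym (at-edge φ u v)

≅-sym : {G : Graph m} {H : Graph n} → G ≅ H → H ≅ G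
≅-sym {H = H} (f , e) = mk↔ₛ′ from to strictlyInverseʳ strictlyInverseˡ , λ u v →
  trans (sym (cong₂ (edge H) (strictlyInverseˡ u) (strictlyInverseˡ v))) (sym (e (from u) (from v)))
  where open Inverse f using (to; from; strictlyInverseˡ; strictlyInverseʳ)

complement-≅⇒≅-complement : {G : Graph m} {H : Graph n} → complement G ≅ H → G ≅ complement H
complement-≅⇒≅-complement {G = G} {H} iso = proj₁ iso , λ u v →
  sym (at-edge (↪-trans (↪-complement² G) (complement-↪ (≅⇒↪ {G = complement G} {H = H} iso))) u v)

≅-complement⇒complement-≅ : {G : Graph m} {H : Graph n} → G ≅ complement H → complement G ≅ H
≅-complement⇒complement-≅ {G = G} {H} iso = proj₁ iso , λ u v →
  sym (at-edge (↪-trans (complement-↪ (≅⇒↪ {G = G} {H = complement H} iso)) (complement²-↪ H)) u v)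

IsEmbedding : Graph m → Graph n → Vec (Fin n) m → Set
IsEmbedding H G f =
  (∀ i j → edge G (lookup f i) (lookup f j) ≡ edge H i j) ×
  (∀ i j → lookup f i ≡ lookup f j → i ≡ j)

embedding? : (H : Graph m) (G : Graph n) → Dec (∃ (IsEmbedding H G))
embedding? H G = anyVec? _ λ f →
  (all? λ i → all? λ j → edge G (lookup f i) (lookup f j) ≟ᵇ edge H i j) ×-dec
  (all? λ i → all? λ j → (lookup f i ≟ lookup f j) →-dec (i ≟ j))

embedding : {H : Graph m} {G : Graph n} → ∃ (IsEmbedding H G) → H ↪ G
embedding (f , e , inj) = record { at = lookup f ; at-injective = inj _ _ ; at-edge = e }

abstract
  -- An embedding is asked for because it can be searched exhaustively; between graphs of order five
  -- it is an isomorphism.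
  P₄-extension : (t : Subset 4) → let H = addVertex P₄ (lookup t) in
    Removable H 3 → Removable (complement H) 3 →
    ∃ (IsEmbedding H P₅) ⊎ ∃ (IsEmbedding H C₅) ⊎ ∃ (IsEmbedding H Bull) ⊎ ∃ (IsEmbedding H House)
  P₄-extension = from-yes (allSubset? 4 λ t → let H = addVertex P₄ (lookup t) in
    removable? H 3 →-dec removable? (complement H) 3 →-dec
    (embedding? H P₅ ⊎-dec embedding? H C₅ ⊎-dec embedding? H Bull ⊎-dec embedding? H House))

abstract
  P₄-removable₂ : Removable P₄ 2
  P₄-removable₂ = from-yes (removable? P₄ 2)

  P₅-removable₃ : Removable P₅ 3 × Removable (complement P₅) 3
  P₅-removable₃ = from-yes (removable? P₅ 3 ×-dec removable? (complement P₅) 3)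

  C₅-removable₃ : Removable C₅ 3 × Removable (complement C₅) 3
  C₅-removable₃ = from-yes (removable? C₅ 3 ×-dec removable? (complement C₅) 3)

  Bull-removable₃ : Removable Bull 3 × Removable (complement Bull) 3
  Bull-removable₃ = from-yes (removable? Bull 3 ×-dec removable? (complement Bull) 3)

  House-removable₃ : Removable House 3 × Removable (complement House) 3
  House-removable₃ = from-yes (removable? House 3 ×-dec removable? (complement House) 3)

IsExtremal : Graph n → Set
IsExtremal G = IsDoubleStar G ⊎ IsStarPlus G

¬removable₃⇒extremal : {G : Graph n} → P₄ ↪ G → Connected G → ¬ Removable G 3 → IsExtremal G
¬removable₃⇒extremal φ con ¬rem with Classification.classification φ con ¬rem
... | inj₁ B = inj₁ (blowup⇒doubleStar B)
... | inj₂ (B , u , v , u≢v , ku , kv) = inj₂ (blowup⇒starPlus B u≢v ku kv)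

-- If P₄ ↪ G, this says that ldNumber G = n - 2 and ldNumber G′ = n - 3.
Tight : Graph n → Graph n → Set
Tight G G′ = ¬ Removable G 3 × Removable G′ 3 × ¬ Removable G′ 4

blowup⇒tight : ∀ {t₁ t₂} → Extremal t₁ t₂ → {G : Graph n} → 5 ≤ n → PathBlowup t₁ t₂ G →
  Tight G (complement G)
blowup⇒tight ext 5≤n B = ¬removable₃ , complement-removable₃ 5≤n , ¬complement-removable₄
  where open Extremality ext B

extremal⇒tight : {G : Graph n} → 5 ≤ n → IsExtremal G → Tight G (complement G)
extremal⇒tight {G = G} 5≤n (inj₁ (r , s , 1≤r , 1≤s , iso)) = blowup⇒tight (inj₁ (refl , refl)) 5≤n
  (blowup-resp-≅ {G = G} {H = doubleStar r s} iso (doubleStar-blowup 1≤r 1≤s))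
extremal⇒tight {G = G} 5≤n (inj₂ (r , s , 2≤s , s≤r , iso)) = blowup⇒tight (inj₂ (refl , refl)) 5≤n
  (blowup-resp-≅ {G = G} {H = starPlus r s} iso (starPlus-blowup 2≤s s≤r))

¬removable⇒≤ldNumber : (G : Graph n) → ¬ Removable G (suc k) → n ≤ ldNumber G + k
¬removable⇒≤ldNumber {k = k} G ¬rem =
  ℕ.≤-trans (s≤s⁻¹ (ℕ.≰⇒> λ le → ¬rem (ldNumber≤⇒removable G le))) (ℕ.≤-reflexive (ℕ.+-comm k _))

-- Adding 5 first keeps the truncated subtraction exact.
2n∸5 : ∀ {a b n} → a + 2 ≡ n → b + 3 ≡ n → a + b ≡ 2 * n ∸ 5
2n∸5 {a} {b} {n} a+2 b+3 = begin
  a + b                ≡⟨ ℕ.m+n∸n≡m (a + b) 5 ⟨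
  a + b + 5 ∸ 5        ≡⟨ cong (_∸ 5) (rearrange a b) ⟩
  a + 2 + (b + 3) ∸ 5  ≡⟨ cong₂ (λ x y → x + y ∸ 5) a+2 (trans b+3 (sym (ℕ.+-identityʳ n))) ⟩
  2 * n ∸ 5            ∎
  where
  open ≡-Reasoning
  rearrange : ∀ a b → a + b + 5 ≡ (a + 2) + (b + 3)
  rearrange = solve-∀

<2n∸5 : ∀ {a b n} → a + 3 ≤ n → b + 3 ≤ n → a + b < 2 * n ∸ 5
<2n∸5 {a} {b} {n} a+3 b+3 = ℕ.m+n≤o⇒m≤o∸n (suc (a + b)) (begin
  suc (a + b) + 5      ≡⟨ rearrange a b ⟩
  (a + 3) + (b + 3)    ≤⟨ ℕ.+-mono-≤ a+3 b+3 ⟩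
  n + n                ≡⟨ cong (n +_) (ℕ.+-identityʳ n) ⟨
  2 * n                ∎)
  where
  open ℕ.≤-Reasoning
  rearrange : ∀ a b → suc (a + b) + 5 ≡ (a + 3) + (b + 3)
  rearrange = solve-∀

-- The induced path supplies the bound `n - 2` for `G`; the parts of `Tight` supply the other three
-- bounds.
tight⇒sum : (G G′ : Graph n) → P₄ ↪ G → Tight G G′ → ldNumber G + ldNumber G′ ≡ 2 * n ∸ 5
tight⇒sum G G′ φ (¬rem₃ , rem₃ , ¬rem₄) = 2n∸5
  (ℕ.≤-antisym (removable⇒ldNumber≤ G (removable-↪ φ P₄-removable₂)) (¬removable⇒≤ldNumber G ¬rem₃))
  (ℕ.≤-antisym (removable⇒ldNumber≤ G′ rem₃) (¬removable⇒≤ldNumber G′ ¬rem₄))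

IsExceptional : Graph n → Set
IsExceptional G = (G ≅ P₅) ⊎ (G ≅ C₅) ⊎ (G ≅ Bull) ⊎ (G ≅ House)

-- At order five the path misses a single vertex, so `G` is a one-vertex extension of `P₄`.
removable₃⇒exceptional : {G : Graph n} → n ≡ 5 → P₄ ↪ G →
  Removable G 3 → Removable (complement G) 3 → IsExceptional G
removable₃⇒exceptional {G = G} refl φ rem rem′ with v , v∉ ← ∃-outside ℕ.≤-refl (at φ) =
  Sum.map (to≅ P₅) (Sum.map (to≅ C₅) (Sum.map (to≅ Bull) (to≅ House)))
    (P₄-extension t (removable-↪ ψ rem) (removable-↪ (complement-↪ ψ) rem′))
  where
  t : Subset 4
  t = tabulate λ i → edge G v (at φ i)

  H : Graph 5
  H = addVertex P₄ (lookup t)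

  iso : G ≅ H
  iso = ≅-sym {G = H} {H = G} (↪⇒≅ (addVertex-↪ φ v v∉ (lookup t) λ i →
    sym (lookup∘tabulate (λ i → edge G v (at φ i)) i)))

  ψ : G ↪ H
  ψ = ≅⇒↪ {G = G} {H = H} iso

  to≅ : (K : Graph 5) → ∃ (IsEmbedding H K) → G ≅ K
  to≅ K e = ↪⇒≅ (↪-trans ψ (embedding {G = K} e))

≅⇒order : {G : Graph m} {H : Graph n} → G ≅ H → m ≡ n
≅⇒order {G = G} {H} iso = ℕ.≤-antisym (injective⇒≤ (at-injective (≅⇒↪ {G = G} {H = H} iso)))
  (injective⇒≤ (at-injective (≅⇒↪ {G = H} {H = G} (≅-sym {G = G} {H = H} iso))))

removable₃⇒ldNumber≡2 : (G : Graph n) → n ≡ 5 → Removable G 3 → ldNumber G ≡ 2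
removable₃⇒ldNumber≡2 G n≡5 rem = ℕ.≤-antisym
  (ℕ.+-cancelʳ-≤ 3 _ 2 (ℕ.≤-trans (removable⇒ldNumber≤ G rem) (ℕ.≤-reflexive n≡5)))
  (2≤ldNumber G (ℕ.≤-reflexive (sym n≡5)))

ldSum≡4 : {G : Graph n} (H : Graph 5) → G ≅ H → Removable H 3 × Removable (complement H) 3 →
  ldNumber G + ldNumber (complement G) ≡ 4
ldSum≡4 {G = G} H iso (rem , rem′) = cong₂ _+_
  (removable₃⇒ldNumber≡2 G order (removable-↪ φ rem))
  (removable₃⇒ldNumber≡2 (complement G) order (removable-↪ (complement-↪ φ) rem′))
  where
  order : _ ≡ 5
  order = ≅⇒order {G = G} {H = H} iso

  φ : H ↪ G
  φ = ≅⇒↪ {G = H} {H = G} (≅-sym {G = G} {H = H} iso)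

exceptional⇒sum : {G : Graph n} → IsExceptional G → ldNumber G + ldNumber (complement G) ≡ 4
exceptional⇒sum (inj₁ iso)               = ldSum≡4 P₅ iso P₅-removable₃
exceptional⇒sum (inj₂ (inj₁ iso))        = ldSum≡4 C₅ iso C₅-removable₃
exceptional⇒sum (inj₂ (inj₂ (inj₁ iso))) = ldSum≡4 Bull iso Bull-removable₃
exceptional⇒sum (inj₂ (inj₂ (inj₂ iso))) = ldSum≡4 House iso House-removable₃

2≤×2≤×+≡4 : ∀ {a b} → 2 ≤ a → 2 ≤ b → a + b ≡ 4 → a ≡ 2 × b ≡ 2
2≤×2≤×+≡4 (s≤s (s≤s {n = zero} _)) (s≤s (s≤s {n = zero} _)) _ = refl , refl
2≤×2≤×+≡4 (s≤s (s≤s {n = zero} _)) (s≤s (s≤s {n = suc _} _)) ()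
2≤×2≤×+≡4 (s≤s (s≤s {n = suc a} _)) (s≤s (s≤s {n = b} _)) eq =
  contradiction (trans (sym (ℕ.+-comm a (suc (suc b))))
    (ℕ.suc-injective (ℕ.suc-injective (ℕ.suc-injective eq)))) λ ()

module _ {n : ℕ} (5≤n : 5 ≤ n) (G : Graph n) (dc : DoublyConnected G) where

  sum : ℕ
  sum = ldNumber G + ldNumber (complement G)

  IsExtremalPair : Set
  IsExtremalPair = IsExtremal G ⊎ IsExtremal (complement G)

  P₄↪G : P₄ ↪ G
  P₄↪G = path 5≤n G dc
    where
    -- The order is generalised so that matching on `5 ≤ n` exposes the successors that
    -- `doublyConnected⇒P₄` expects.
    path : ∀ {n} → 5 ≤ n → (G : Graph n) → DoublyConnected G → P₄ ↪ G
    path (s≤s (s≤s _)) = doublyConnected⇒P₄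

  P₄↪complement : P₄ ↪ complement G
  P₄↪complement = ↪-trans P₄-↪-complement (complement-↪ P₄↪G)

  4≤sum : 4 ≤ sum
  4≤sum = ℕ.+-mono-≤ (2≤ldNumber G 5≤n) (2≤ldNumber (complement G) 5≤n)

  sum≡4⇒exceptional : sum ≡ 4 → IsExceptional G
  sum≡4⇒exceptional eq
    with ld≡2 , ld′≡2 ← 2≤×2≤×+≡4 (2≤ldNumber G 5≤n) (2≤ldNumber (complement G) 5≤n) eq =
    removable₃⇒exceptional order P₄↪G (removable G ld≡2) (removable (complement G) ld′≡2)
    where
    removable : (G : Graph n) → ldNumber G ≡ 2 → Removable G 3
    removable G ld≡2 = ldNumber≤⇒removable G (subst (λ d → 3 + d ≤ n) (sym ld≡2) 5≤n)

    order : n ≡ 5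
    -- For `d = 2` the counting bound reads `n < 2 + 4`.
    order = ℕ.≤-antisym (s≤s⁻¹ (subst (λ d → n < d + 2 ^ d) ld≡2 (order<ld+2^ld G))) 5≤n

  extremal⇒sum : IsExtremalPair → sum ≡ 2 * n ∸ 5
  extremal⇒sum (inj₁ ext) = tight⇒sum G (complement G) P₄↪G (extremal⇒tight {G = G} 5≤n ext)
  extremal⇒sum (inj₂ ext) with ¬rem₃ , rem₃ , ¬rem₄ ← extremal⇒tight {G = complement G} 5≤n ext =
    -- Tightness of `complement G` concerns the double complement and is carried back to `G`.
    trans (ℕ.+-comm (ldNumber G) _) (tight⇒sum (complement G) G P₄↪complement
      (¬rem₃ , removable-↪ (complement²-↪ G) rem₃ , ¬rem₄ ∘ removable-↪ (↪-complement² G)))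

  -- If both graphs have a removable triple, both numbers are at most `n - 3` and the sum is at most
  -- `2 n - 6`. Otherwise the classification applies to the graph without one.
  extremal⊎sum< : IsExtremalPair ⊎ sum < 2 * n ∸ 5
  extremal⊎sum< with removable? G 3 | removable? (complement G) 3
  ... | no ¬rem | _ = inj₁ (inj₁ (¬removable₃⇒extremal P₄↪G (proj₁ dc) ¬rem))
  ... | _ | no ¬rem = inj₁ (inj₂ (¬removable₃⇒extremal P₄↪complement (proj₂ dc) ¬rem))
  ... | yes rem | yes rem′ =
    inj₂ (<2n∸5 (removable⇒ldNumber≤ G rem) (removable⇒ldNumber≤ (complement G) rem′))

  sum≤ : sum ≤ 2 * n ∸ 5
  sum≤ with extremal⊎sum<
  ... | inj₁ ext = ℕ.≤-reflexive (extremal⇒sum ext)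
  ... | inj₂ lt  = ℕ.<⇒≤ lt

  sum≡⇒extremal : sum ≡ 2 * n ∸ 5 → IsExtremalPair
  sum≡⇒extremal eq with extremal⊎sum<
  ... | inj₁ ext = ext
  ... | inj₂ lt  = contradiction eq (ℕ.<⇒≢ lt)

theorem6 : (n : ℕ) → 5 ≤ n → (G : Graph n) → DoublyConnected G →
    (4 ≤ ldNumber G + ldNumber (complement G)) ×
    (ldNumber G + ldNumber (complement G) ≤ 2 * n ∸ 5) ×
    (ldNumber G + ldNumber (complement G) ≡ 4 ⇔
    ((G ≅ P₅) ⊎ (G ≅ C₅) ⊎ (G ≅ Bull) ⊎ (G ≅ House))) ×
    (ldNumber G + ldNumber (complement G) ≡ 2 * n ∸ 5 ⇔
    ((∃₂ λ (r s : ℕ) → 1 ≤ r × 1 ≤ s × (G ≅ doubleStar r s)) ⊎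
    (∃₂ λ (r s : ℕ) → 1 ≤ r × 1 ≤ s × (G ≅ complement (doubleStar r s))) ⊎
    (∃₂ λ (r s : ℕ) → 2 ≤ s × s ≤ r ∸ 1 × (G ≅ starPlus r s)) ⊎
    (∃₂ λ (r s : ℕ) → 2 ≤ s × s ≤ r ∸ 1 × (G ≅ complement (starPlus r s)))))
theorem6 n 5≤n G dc =
    4≤sum 5≤n G dc
  , sum≤ 5≤n G dc
  , mk⇔ (sum≡4⇒exceptional 5≤n G dc) (exceptional⇒sum)
  , mk⇔ (families ∘ sum≡⇒extremal 5≤n G dc) (extremal⇒sum 5≤n G dc ∘ extremal)
  where
  -- Extremality of the complement becomes membership of `G` in a family of complements.
  families : _ → _
  families (inj₁ (inj₁ ds)) = inj₁ ds
  families (inj₂ (inj₁ (r , s , 1≤r , 1≤s , iso))) = inj₂ (inj₁ (r , s , 1≤r , 1≤s ,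
    complement-≅⇒≅-complement {G = G} {H = doubleStar r s} iso))
  families (inj₁ (inj₂ sp)) = inj₂ (inj₂ (inj₁ sp))
  families (inj₂ (inj₂ (r , s , 2≤s , s≤r , iso))) = inj₂ (inj₂ (inj₂ (r , s , 2≤s , s≤r ,
    complement-≅⇒≅-complement {G = G} {H = starPlus r s} iso)))

  extremal : _ → _
  extremal (inj₁ ds) = inj₁ (inj₁ ds)
  extremal (inj₂ (inj₁ (r , s , 1≤r , 1≤s , iso))) = inj₂ (inj₁ (r , s , 1≤r , 1≤s ,
    ≅-complement⇒complement-≅ {G = G} {H = doubleStar r s} iso))
  extremal (inj₂ (inj₂ (inj₁ sp))) = inj₁ (inj₂ sp)
  extremal (inj₂ (inj₂ (inj₂ (r , s , 2≤s , s≤r , iso)))) = inj₂ (inj₂ (r , s , 2≤s , s≤r ,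
    ≅-complement⇒complement-≅ {G = G} {H = starPlus r s} iso))
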